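{- Let $\sigma$ be a unimodular morphism of $F_d$. If the image of a stepped surface under $E_1^*(\sigma)$ is a binary stepped function, then it is a stepped surface: $E_1^*(\sigma)(\mathfrak{S})\cap\mathfrak{B}\subset\mathfrak{S}$.
   Context: Fix an integer $d\geq 3$; $(\vec{e}_1,\ldots,\vec{e}_d)$ is the canonical basis of $\mathbb{R}^d$. A stepped function is a function $\mathcal{E}:\mathbb{Z}^d\times\{1,\ldots,d\}\to\mathbb{Z}$; the set of stepped functions is denoted $\mathfrak{F}$. It is binary if it takes only the values $0$ and $1$; $\mathfrak{B}$ is the set of binary stepped functions. The geometric interpretation of $\mathcal{B}\in\mathfrak{B}$ is the union, over all $(\vec{x},i)$ with $\mathcal{B}(\vec{x},i)=1$, of the facets $\{\vec{x}+\vec{e}_i+\sum_{j\neq i}\lambda_j\vec{e}_j \mid 0\leq\lambda_j\leq 1\}$. Let $\pi$ be the orthogonal projection of $\mathbb{R}^d$ onto $\Delta=\{\vec{x} \mid x_1+\cdots+x_d=0\}$. A stepped surface is a binary stepped function whose geometric interpretation is homeomorphic to $\Delta$ under $\pi$ (i.e. the restriction of $\pi$ to it is a homeomorphism onto $\Delta$); $\mathfrak{S}$ is the set of stepped surfaces. $F_d$ is the free group on the alphabet $\{1,\ldots,d\}$; its elements are written in reduced form. The Abelianization map $\vec{f}:F_d\to\mathbb{Z}^d$ sends $w$ to the vector whose $i$-th entry is the sum of the exponents of the occurrences of $i$ in $w$. A morphism $\sigma$ of $F_d$ is a group endomorphism; its incidence matrix $M_\sigma$ is the $d\times d$ integer matrix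 whose $i$-th column is $\vec{f}(\sigma(i))$; $\sigma$ is unimodular if $\det M_\sigma=\pm 1$. The dual map $E_1^*(\sigma):\mathfrak{F}\to\mathfrak{F}$ of a unimodular morphism $\sigma$ is defined by $$E_1^*(\sigma)(\mathcal{E})(\vec{x},i)=\sum_{\sigma(i)=p\cdot j\cdot s}\mathcal{E}(M_\sigma\vec{x}+\vec{f}(p),j)-\sum_{\sigma(i)=p\cdot j^{ -1}\cdot s}\mathcal{E}(M_\sigma\vec{x}+\vec{f}(p)-\vec{e}_j,j),$$ where the first (resp. second) sum ranges over all occurrences in the reduced word $\sigma(i)$ of letters $j$ (resp. inverse letters $j^{ -1}$), $1\leq j\leq d$, with $p$ the prefix before and $s$ the suffix after that occurrence. -}

module Defs where

open import Algebra.Bundles using (CommutativeMonoid; Group)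
open import Algebra.Morphism.Bundles using (GroupHomomorphism)
open import Data.Bool.Base using (if_then_else_)
open import Data.Fin.Base as Fin using (Fin)
import Data.Fin.Properties as Fin
open import Data.Integer.Base as ℤ using (ℤ; 0ℤ; 1ℤ; -1ℤ)
import Data.Integer.Properties as ℤ
open import Data.List.Base using (List; []; _∷_; _++_; foldr; length; take; [_])
import Data.List.Base as List
import Data.List.Properties as List
open import Data.List.Relation.Unary.Linked as Linked using (Linked; []; [-]; _∷_)
open import Data.Nat.Base as ℕ using (ℕ; zero; suc; NonZero)
import Data.Nat.Properties as ℕ
open import Data.Product.Base using (Σ-syntax; ∃-syntax; _×_; _,_)
open import Data.Rational.Base as ℚ using (ℚ; 0ℚ; ½)
import Data.Rational.Properties as ℚ
open import Data.Sum.Base using (_⊎_)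
open import Data.Vec.Base using (Vec; lookup; tabulate; replicate; zipWith; _[_]≔_)
open import Data.Vec.Functional as Vector using (Vector; removeAt)
open import Level using (0ℓ)
open import Relation.Binary.PropositionalEquality
  using (_≡_; _≢_; refl; sym; trans; cong; subst)
open import Relation.Nullary.Negation.Core using (contradiction)
open import Relation.Nullary.Decidable.Core using (Dec; yes; no; does; map′)

open import Algebra.Properties.CommutativeSemigroup
  (CommutativeMonoid.commutativeSemigroup ℚ.+-0-commutativeMonoid) using (interchange)
import Algebra.Properties.CommutativeMonoid.Sum ℤ.+-0-commutativeMonoid as ℤΣ

------------------------------------------------------------------------
-- Real numbers: Cauchy sequences of rationals, with setoid equality ≈ᴿ

record ℝ : Set where
  field
    seq    : ℕ → ℚ
    cauchy : ∀ (ε : ℚ) → 0ℚ ℚ.< ε →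
             ∃[ N ] ∀ m n → N ℕ.≤ m → N ℕ.≤ n → ℚ.∣ seq m ℚ.- seq n ∣ ℚ.< ε
open ℝ public

infix 4 _<ᴿ_ _≤ᴿ_ _≈ᴿ_
infixl 6 _+ᴿ_ _-ᴿ_
infix 8 -ᴿ_
infixl 7 _*ᴿ_

_<ᴿ_ : ℝ → ℝ → Set
x <ᴿ y = ∃[ ε ] 0ℚ ℚ.< ε ×
         (∃[ N ] ∀ n → N ℕ.≤ n → seq x n ℚ.+ ε ℚ.< seq y n)

_≤ᴿ_ : ℝ → ℝ → Set
x ≤ᴿ y = ∀ (ε : ℚ) → 0ℚ ℚ.< ε →
         ∃[ N ] ∀ n → N ℕ.≤ n → seq x n ℚ.< seq y n ℚ.+ ε

_≈ᴿ_ : ℝ → ℝ → Set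
x ≈ᴿ y = x ≤ᴿ y × y ≤ᴿ x

fromℚ : ℚ → ℝ
fromℚ q .seq _ = q
fromℚ q .cauchy ε 0<ε = 0 , λ _ _ _ _ →
  subst (ℚ._< ε) (sym (cong ℚ.∣_∣ (ℚ.+-inverseʳ q))) 0<ε

fromℤ : ℤ → ℝ
fromℤ z = fromℚ (z ℚ./ 1)

0ᴿ 1ᴿ : ℝ
0ᴿ = fromℚ 0ℚ
1ᴿ = fromℚ ℚ.1ℚ

private
  *-pos : ∀ q .{{_ : ℚ.Positive q}} {ε} → 0ℚ ℚ.< ε → 0ℚ ℚ.< q ℚ.* ε
  *-pos q {ε} 0<ε = subst (ℚ._< q ℚ.* ε) (ℚ.*-zeroʳ q) (ℚ.*-monoʳ-<-pos q 0<ε)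

  halves : ∀ ε → ½ ℚ.* ε ℚ.+ ½ ℚ.* ε ≡ ε
  halves ε = trans (sym (ℚ.*-distribʳ-+ ε ½ ½)) (ℚ.*-identityˡ ε)

  diff-+ : ∀ a b c d → (a ℚ.+ b) ℚ.- (c ℚ.+ d) ≡ (a ℚ.- c) ℚ.+ (b ℚ.- d)
  diff-+ a b c d = trans (cong ((a ℚ.+ b) ℚ.+_) (ℚ.neg-distrib-+ c d))
                         (interchange a b (ℚ.- c) (ℚ.- d))

  diff-* : ∀ q a b → q ℚ.* a ℚ.- q ℚ.* b ≡ q ℚ.* (a ℚ.- b)
  diff-* q a b = trans (cong (q ℚ.* a ℚ.+_) (ℚ.neg-distribʳ-* q b))
                       (sym (ℚ.*-distribˡ-+ q a (ℚ.- b)))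

_+ᴿ_ : ℝ → ℝ → ℝ
(x +ᴿ y) .seq n = seq x n ℚ.+ seq y n
(x +ᴿ y) .cauchy ε 0<ε =
  let N₁ , p = cauchy x (½ ℚ.* ε) (*-pos ½ 0<ε)
      N₂ , q = cauchy y (½ ℚ.* ε) (*-pos ½ 0<ε)
  in N₁ ℕ.⊔ N₂ , λ m n N≤m N≤n → begin-strict
    ℚ.∣ (seq x m ℚ.+ seq y m) ℚ.- (seq x n ℚ.+ seq y n) ∣
      ≡⟨ cong ℚ.∣_∣ (diff-+ (seq x m) (seq y m) (seq x n) (seq y n)) ⟩
    ℚ.∣ (seq x m ℚ.- seq x n) ℚ.+ (seq y m ℚ.- seq y n) ∣
      ≤⟨ ℚ.∣p+q∣≤∣p∣+∣q∣ (seq x m ℚ.- seq x n) (seq y m ℚ.- seq y n) ⟩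
    ℚ.∣ seq x m ℚ.- seq x n ∣ ℚ.+ ℚ.∣ seq y m ℚ.- seq y n ∣
      <⟨ ℚ.+-mono-< (p m n (ℕ.m⊔n≤o⇒m≤o N₁ N₂ N≤m) (ℕ.m⊔n≤o⇒m≤o N₁ N₂ N≤n))
                    (q m n (ℕ.m⊔n≤o⇒n≤o N₁ N₂ N≤m) (ℕ.m⊔n≤o⇒n≤o N₁ N₂ N≤n)) ⟩
    ½ ℚ.* ε ℚ.+ ½ ℚ.* ε
      ≡⟨ halves ε ⟩
    ε ∎
  where open ℚ.≤-Reasoning

-- Only rational scalars are needed.
_*ᴿ_ : ℚ → ℝ → ℝ
(q *ᴿ x) .seq n = q ℚ.* seq x n
(q *ᴿ x) .cauchy ε 0<ε =
  let N , p = cauchy x (b⁻¹ ℚ.* ε) (*-pos b⁻¹ 0<ε)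
  in N , λ m n N≤m N≤n → begin-strict
    ℚ.∣ q ℚ.* seq x m ℚ.- q ℚ.* seq x n ∣
      ≡⟨ cong ℚ.∣_∣ (diff-* q (seq x m) (seq x n)) ⟩
    ℚ.∣ q ℚ.* (seq x m ℚ.- seq x n) ∣
      ≡⟨ ℚ.∣p*q∣≡∣p∣*∣q∣ q (seq x m ℚ.- seq x n) ⟩
    ℚ.∣ q ∣ ℚ.* ℚ.∣ seq x m ℚ.- seq x n ∣
      ≤⟨ ℚ.*-monoʳ-≤-nonNeg ℚ.∣ seq x m ℚ.- seq x n ∣ {{ℚ.∣-∣-nonNeg (seq x m ℚ.- seq x n)}} ∣q∣≤b ⟩
    b ℚ.* ℚ.∣ seq x m ℚ.- seq x n ∣
      <⟨ ℚ.*-monoʳ-<-pos b (p m n N≤m N≤n) ⟩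
    b ℚ.* (b⁻¹ ℚ.* ε)
      ≡⟨ trans (sym (ℚ.*-assoc b b⁻¹ ε)) (trans (cong (ℚ._* ε) (ℚ.*-inverseʳ b)) (ℚ.*-identityˡ ε)) ⟩
    ε ∎
  where
  open ℚ.≤-Reasoning
  b : ℚ
  b = ℚ.∣ q ∣ ℚ.+ ℚ.1ℚ
  instance
    b-pos : ℚ.Positive b
    b-pos = ℚ.nonNeg+pos⇒pos ℚ.∣ q ∣ {{ℚ.∣-∣-nonNeg q}} ℚ.1ℚ
    b-nonZero : ℚ.NonZero b
    b-nonZero = ℚ.pos⇒nonZero b
  b⁻¹ : ℚ
  b⁻¹ = ℚ.1/ b
  instance
    b⁻¹-pos : ℚ.Positive b⁻¹
    b⁻¹-pos = ℚ.1/pos⇒pos b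
  ∣q∣≤b : ℚ.∣ q ∣ ℚ.≤ b
  ∣q∣≤b = subst (ℚ._≤ b) (ℚ.+-identityʳ ℚ.∣ q ∣) (ℚ.+-monoʳ-≤ ℚ.∣ q ∣ (ℚ.nonNegative⁻¹ ℚ.1ℚ))

-ᴿ_ : ℝ → ℝ
(-ᴿ x) .seq n = ℚ.- seq x n
(-ᴿ x) .cauchy ε 0<ε =
  let N , p = cauchy x ε 0<ε
  in N , λ m n N≤m N≤n → subst (ℚ._< ε)
    (sym (trans (cong ℚ.∣_∣ (sym (ℚ.neg-distrib-+ (seq x m) (ℚ.- seq x n))))
                (ℚ.∣-p∣≡∣p∣ (seq x m ℚ.- seq x n))))
    (p m n N≤m N≤n)

_-ᴿ_ : ℝ → ℝ → ℝ
x -ᴿ y = x +ᴿ (-ᴿ y)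

------------------------------------------------------------------------
-- ℝⁿ with its product topology, and homeomorphisms between subsets

ℝ^ : ℕ → Set
ℝ^ n = Vector ℝ n

Subset : ℕ → Set₁
Subset n = ℝ^ n → Set

infix 4 _≋_

_≋_ : ∀ {n} → ℝ^ n → ℝ^ n → Set
p ≋ q = ∀ k → p k ≈ᴿ q k

-- "the sup-norm distance of p and q is less than ε" (for 0 < ε)
Close : ∀ {n} → ℝ → ℝ^ n → ℝ^ n → Set
Close ε p q = ∀ k → (p k -ᴿ q k) <ᴿ ε × (q k -ᴿ p k) <ᴿ ε

MapsTo : ∀ {m n} → (ℝ^ m → ℝ^ n) → Subset m → Subset n → Set
MapsTo f A B = ∀ p → A p → B (f p)

-- Continuity for the subspace topology on A; it entails that f respects
-- ≋ on A.
ContinuousOn : ∀ {m n} → (ℝ^ m → ℝ^ n) → Subset m → Set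
ContinuousOn f A =
  ∀ p → A p → ∀ ε → 0ᴿ <ᴿ ε →
  ∃[ δ ] 0ᴿ <ᴿ δ × (∀ q → A q → Close δ p q → Close ε (f p) (f q))

record RestrictsToHomeomorphism {m n} (f : ℝ^ m → ℝ^ n)
                                (A : Subset m) (B : Subset n) : Set where
  field
    inverse      : ℝ^ n → ℝ^ m
    to           : MapsTo f A B
    from         : MapsTo inverse B A
    inverseˡ     : ∀ p → A p → inverse (f p) ≋ p
    inverseʳ     : ∀ q → B q → f (inverse q) ≋ q
    to-continuous   : ContinuousOn f A
    from-continuous : ContinuousOn inverse B

sumᴿ : ∀ {n} → ℝ^ n → ℝ
sumᴿ = Vector.foldr _+ᴿ_ 0ᴿ

Δ : ∀ d → Subset d
Δ d p = sumᴿ p ≈ᴿ 0ᴿ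

-- Orthogonal projection onto Δ along its normal (1,…,1):
-- π(p) = p - ((p₁ + ⋯ + p_d) / d) (1,…,1).
π : ∀ {d} .{{_ : NonZero d}} → ℝ^ d → ℝ^ d
π {d} p k = p k -ᴿ (ℤ.+ 1 ℚ./ d) *ᴿ sumᴿ p

------------------------------------------------------------------------
-- ℤᵈ and stepped functions

infixl 6 _+ᵛ_ _-ᵛ_

_+ᵛ_ _-ᵛ_ : ∀ {d} → Vec ℤ d → Vec ℤ d → Vec ℤ d
_+ᵛ_ = zipWith ℤ._+_
_-ᵛ_ = zipWith ℤ._-_

0ᵛ : ∀ {d} → Vec ℤ d
0ᵛ = replicate _ 0ℤ

e : ∀ {d} → Fin d → Vec ℤ d
e i = 0ᵛ [ i ]≔ 1ℤ

SteppedFunction : ℕ → Set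
SteppedFunction d = Vec ℤ d → Fin d → ℤ

IsBinary : ∀ {d} → SteppedFunction d → Set
IsBinary E = ∀ x i → E x i ≡ 0ℤ ⊎ E x i ≡ 1ℤ

-- { x + eᵢ + Σ_{j≠i} λⱼ eⱼ ∣ 0 ≤ λⱼ ≤ 1 }; the value of `λ′ i` is irrelevant.
Facet : ∀ {d} → Vec ℤ d → Fin d → Subset d
Facet {d} x i p =
  Σ[ λ′ ∈ (Fin d → ℝ) ]
    (∀ j → j ≢ i → 0ᴿ ≤ᴿ λ′ j × λ′ j ≤ᴿ 1ᴿ) ×
    p ≋ (λ k → fromℤ (lookup (x +ᵛ e i) k)
               +ᴿ (if does (k Fin.≟ i) then 0ᴿ else λ′ k))

GeometricInterpretation : ∀ {d} → SteppedFunction d → Subset d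
GeometricInterpretation B p = ∃[ x ] ∃[ i ] B x i ≡ 1ℤ × Facet x i p

IsSteppedSurface : ∀ {d} .{{_ : NonZero d}} → SteppedFunction d → Set
IsSteppedSurface {d} E =
  IsBinary E × RestrictsToHomeomorphism π (GeometricInterpretation E) (Δ d)

------------------------------------------------------------------------
-- The free group: words modulo cancellation of l l⁻¹

data Letter (d : ℕ) : Set where
  gen gen⁻¹ : Fin d → Letter d

flip : ∀ {d} → Letter d → Letter d
flip (gen j)   = gen⁻¹ j
flip (gen⁻¹ j) = gen j

Word : ℕ → Set
Word d = List (Letter d)

infix 4 _≈ᶠ_

data _≈ᶠ_ {d} : Word d → Word d → Set where
  ≈-refl   : ∀ {u} → u ≈ᶠ u
  ≈-sym    : ∀ {u v} → u ≈ᶠ v → v ≈ᶠ u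
  ≈-trans  : ∀ {u v w} → u ≈ᶠ v → v ≈ᶠ w → u ≈ᶠ w
  ++-cong  : ∀ {u u′ v v′} → u ≈ᶠ u′ → v ≈ᶠ v′ → u ++ v ≈ᶠ u′ ++ v′
  cancel   : ∀ l → l ∷ flip l ∷ [] ≈ᶠ []

invert : ∀ {d} → Word d → Word d
invert []      = []
invert (l ∷ w) = invert w ++ [ flip l ]

private
  ≈-reflexive : ∀ {d} {u v : Word d} → u ≡ v → u ≈ᶠ v
  ≈-reflexive refl = ≈-refl

  flip-flip : ∀ {d} (l : Letter d) → flip (flip l) ≡ l
  flip-flip (gen _)   = refl
  flip-flip (gen⁻¹ _) = refl

  invert-++ : ∀ {d} (u v : Word d) → invert (u ++ v) ≡ invert v ++ invert u
  invert-++ []      v = sym (List.++-identityʳ (invert v))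
  invert-++ (l ∷ u) v = trans (cong (_++ [ flip l ]) (invert-++ u v))
                              (List.++-assoc (invert v) (invert u) [ flip l ])

  cancelˡ : ∀ {d} (l : Letter d) → flip l ∷ l ∷ [] ≈ᶠ []
  cancelˡ l = subst (λ m → flip l ∷ m ∷ [] ≈ᶠ []) (flip-flip l) (cancel (flip l))

  invert-cong : ∀ {d} {u v : Word d} → u ≈ᶠ v → invert u ≈ᶠ invert v
  invert-cong ≈-refl        = ≈-refl
  invert-cong (≈-sym p)     = ≈-sym (invert-cong p)
  invert-cong (≈-trans p q) = ≈-trans (invert-cong p) (invert-cong q)
  invert-cong (++-cong {u} {u′} {v} {v′} p q) =
    ≈-trans (≈-reflexive (invert-++ u v))
      (≈-trans (++-cong (invert-cong q) (invert-cong p))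
               (≈-reflexive (sym (invert-++ u′ v′))))
  invert-cong (cancel l) = cancelˡ (flip l)

  invert-inverseʳ : ∀ {d} (w : Word d) → w ++ invert w ≈ᶠ []
  invert-inverseʳ []      = ≈-refl
  invert-inverseʳ (l ∷ w) =
    ≈-trans (≈-reflexive (cong (l ∷_) (sym (List.++-assoc w (invert w) [ flip l ]))))
      (≈-trans (++-cong (≈-refl {u = [ l ]})
                        (++-cong (invert-inverseʳ w) (≈-refl {u = [ flip l ]})))
               (cancel l))

  invert-inverseˡ : ∀ {d} (w : Word d) → invert w ++ w ≈ᶠ []
  invert-inverseˡ []      = ≈-refl
  invert-inverseˡ (l ∷ w) =
    ≈-trans (≈-reflexive (List.++-assoc (invert w) [ flip l ] (l ∷ w)))
      (≈-trans (++-cong (≈-refl {u = invert w})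
                        (++-cong (cancelˡ l) (≈-refl {u = w})))
               (invert-inverseˡ w))

FreeGroup : ℕ → Group 0ℓ 0ℓ
FreeGroup d = record
  { Carrier = Word d
  ; _≈_     = _≈ᶠ_
  ; _∙_     = _++_
  ; ε       = []
  ; _⁻¹     = invert
  ; isGroup = record
    { isMonoid = record
      { isSemigroup = record
        { isMagma = record
          { isEquivalence = record { refl = ≈-refl ; sym = ≈-sym ; trans = ≈-trans }
          ; ∙-cong = ++-cong
          }
        ; assoc = λ u v w → ≈-reflexive (List.++-assoc u v w)
        }
      ; identity = (λ _ → ≈-refl) , (λ w → ≈-reflexive (List.++-identityʳ w))
      }
    ; inverse = invert-inverseˡ , invert-inverseʳ
    ; ⁻¹-cong = invert-cong
    }
  }

_≟ᴸ_ : ∀ {d} (l m : Letter d) → Dec (l ≡ m)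
gen i   ≟ᴸ gen j   = map′ (cong gen) (λ { refl → refl }) (i Fin.≟ j)
gen i   ≟ᴸ gen⁻¹ j = no λ ()
gen⁻¹ i ≟ᴸ gen j   = no λ ()
gen⁻¹ i ≟ᴸ gen⁻¹ j = map′ (cong gen⁻¹) (λ { refl → refl }) (i Fin.≟ j)

-- The reduced form of l w, for w reduced.
cons : ∀ {d} → Letter d → Word d → Word d
cons l []      = l ∷ []
cons l (m ∷ w) with m ≟ᴸ flip l
... | yes _ = w
... | no  _ = l ∷ m ∷ w

reduce : ∀ {d} → Word d → Word d
reduce = foldr cons []

IsReduced : ∀ {d} → Word d → Set
IsReduced = Linked (λ l m → m ≢ flip l)

private
  cons-reduced : ∀ {d} (l : Letter d) {w} → IsReduced w → IsReduced (cons l w)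
  cons-reduced l {[]}    _ = [-]
  cons-reduced l {m ∷ w} r with m ≟ᴸ flip l
  ... | yes _   = Linked.tail r
  ... | no  m≢l = m≢l ∷ r

  cons-flip : ∀ {d} (l : Letter d) {w} → IsReduced w → cons l (cons (flip l) w) ≡ w
  cons-flip l {[]} _ with flip l ≟ᴸ flip l
  ... | yes _  = refl
  ... | no  ¬p = contradiction refl ¬p
  cons-flip l {m ∷ w} r with m ≟ᴸ flip (flip l)
  cons-flip l {m ∷ []} r | yes p =
    cong [_] (sym (trans p (flip-flip l)))
  cons-flip l {m ∷ n ∷ w} (n≢ ∷ _) | yes p with trans p (flip-flip l)
  ... | refl with n ≟ᴸ flip m
  ...   | yes q = contradiction q n≢
  ...   | no  _ = refl
  cons-flip l {m ∷ w} r | no _ with flip l ≟ᴸ flip l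
  ... | yes _  = refl
  ... | no  ¬p = contradiction refl ¬p

  foldr-cons-reduced : ∀ {d} (u : Word d) {w} → IsReduced w → IsReduced (foldr cons w u)
  foldr-cons-reduced []      r = r
  foldr-cons-reduced (l ∷ u) r = cons-reduced l (foldr-cons-reduced u r)

  foldr-cons-cong : ∀ {d} {u v : Word d} → u ≈ᶠ v →
                    ∀ {w} → IsReduced w → foldr cons w u ≡ foldr cons w v
  foldr-cons-cong ≈-refl        r = refl
  foldr-cons-cong (≈-sym p)     r = sym (foldr-cons-cong p r)
  foldr-cons-cong (≈-trans p q) r = trans (foldr-cons-cong p r) (foldr-cons-cong q r)
  foldr-cons-cong (++-cong {u} {u′} {v} {v′} p q) {w} r =
    trans (List.foldr-++ cons w u v)
      (trans (foldr-cons-cong p (foldr-cons-reduced v r))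
        (trans (cong (λ z → foldr cons z u′) (foldr-cons-cong q r))
               (sym (List.foldr-++ cons w u′ v′))))
  foldr-cons-cong (cancel l) r = cons-flip l r

  cons-≈ : ∀ {d} (l : Letter d) (w : Word d) → cons l w ≈ᶠ l ∷ w
  cons-≈ l []      = ≈-refl
  cons-≈ l (m ∷ w) with m ≟ᴸ flip l
  ... | yes refl = ≈-sym (++-cong (cancel l) (≈-refl {u = w}))
  ... | no  _    = ≈-refl

-- `reduce w` is the unique reduced word representing the same element as w.
reduce-≈ : ∀ {d} (w : Word d) → reduce w ≈ᶠ w
reduce-≈ []      = ≈-refl
reduce-≈ (l ∷ w) = ≈-trans (cons-≈ l (reduce w)) (++-cong (≈-refl {u = [ l ]}) (reduce-≈ w))

reduce-reduced : ∀ {d} (w : Word d) → IsReduced (reduce w)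
reduce-reduced w = foldr-cons-reduced w []

reduce-cong : ∀ {d} {u v : Word d} → u ≈ᶠ v → reduce u ≡ reduce v
reduce-cong p = foldr-cons-cong p []

abelianize : ∀ {d} → Word d → Vec ℤ d
abelianize []            = 0ᵛ
abelianize (gen j   ∷ w) = abelianize w +ᵛ e j
abelianize (gen⁻¹ j ∷ w) = abelianize w -ᵛ e j

------------------------------------------------------------------------
-- Determinants

Matrix : ℕ → Set
Matrix n = Fin n → Fin n → ℤ

-- Laplace expansion along the first row.
det : ∀ {n} → Matrix n → ℤ
det {zero}  M = 1ℤ
det {suc n} M = ℤΣ.sum λ j →
  (-1ℤ ℤ.^ Fin.toℕ j) ℤ.* M Fin.zero j ℤ.* det (λ r → removeAt (M (Fin.suc r)) j)

_·_ : ∀ {n} → Matrix n → Vec ℤ n → Vec ℤ n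
M · x = tabulate λ k → ℤΣ.sum λ j → M k j ℤ.* lookup x j

------------------------------------------------------------------------
-- Morphisms of the free group and their dual maps

Morphism : ℕ → Set
Morphism d = GroupHomomorphism (Group.rawGroup (FreeGroup d)) (Group.rawGroup (FreeGroup d))

-- σ(i) in reduced form
image : ∀ {d} → Morphism d → Fin d → Word d
image σ i = reduce (GroupHomomorphism.⟦_⟧ σ [ gen i ])

incidence : ∀ {d} → Morphism d → Matrix d
incidence σ k i = lookup (abelianize (image σ i)) k

IsUnimodular : ∀ {d} → Morphism d → Set
IsUnimodular σ = det (incidence σ) ≡ 1ℤ ⊎ det (incidence σ) ≡ -1ℤ

-- Contribution of an occurrence of a letter preceded by the prefix p.
term : ∀ {d} → SteppedFunction d → Vec ℤ d → Word d → Letter d → ℤ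
term E y p (gen j)   = E (y +ᵛ abelianize p) j
term E y p (gen⁻¹ j) = ℤ.- E (y +ᵛ abelianize p -ᵛ e j) j

-- The two sums over the occurrences of letters and of inverse letters in
-- σ(i) are merged into one signed sum over the positions in σ(i).
E₁* : ∀ {d} → Morphism d → SteppedFunction d → SteppedFunction d
E₁* σ E x i = ℤΣ.sum {length (image σ i)} λ n →
  term E (incidence σ · x) (take (Fin.toℕ n) (image σ i)) (List.lookup (image σ i) n)

{-# OPTIONS --safe #-}
module Submission where

-- A stepped surface is the boundary of the union of the unit cubes indexed
-- by a down-set D of ℤᵈ: with χ the indicator of D, E(x,i) = χ(x) − χ(x + eᵢ).
-- Dual maps respect this form, because the sum defining E₁*(σ) telescopes
-- along σ(i) and E₁*(σ)(E)(x,i) = χ(Mx) − χ(M(x + eᵢ)).  If this is binary,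
-- then M⁻¹D is a down-set, and M being onto ℤᵈ, it is neither empty nor ℤᵈ.
--
-- For a surface E, D is found from the height of x, the integer h for which
-- x + h(1,…,1) lies on the surface; looking above the centres of the facets
-- shows that heights of neighbours differ by at most one and determine E.
-- Conversely, the line through a point q of ℝᵈ along (1,…,1) meets the
-- boundary of a proper down-set in exactly one point q + t(q)(1,…,1), where
-- t is 1-Lipschitz for the sup-norm, so that projecting along (1,…,1) is a
-- homeomorphism.

open import Defs
open import Axiom.ExcludedMiddle using (ExcludedMiddle)
open import Data.Bool.Base using (if_then_else_)
open import Data.Fin.Base as Fin using (Fin; zero; suc; punchIn; toℕ)
import Data.Fin.Properties as Fin
open import Data.Integer.Base as ℤ using (ℤ; 0ℤ; 1ℤ; -1ℤ; -[1+_])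
import Data.Integer.Properties as ℤ
open import Data.Integer.Tactic.RingSolver using () renaming (solve-∀ to solveℤ)
open import Data.List.Base as List using ([]; _∷_; length; take)
open import Data.Nat.Base as ℕ using (ℕ; zero; suc; NonZero)
import Data.Nat.Properties as ℕ
open import Data.Product.Base using (_×_; _,_; proj₁; proj₂; ∃-syntax; Σ-syntax)
open import Data.Rational.Base as ℚ using (ℚ; 0ℚ; 1ℚ; ½)
import Data.Rational.Properties as ℚ
import Data.Rational.Unnormalised.Base as ℚᵘ
import Data.Rational.Unnormalised.Properties as ℚᵘ
open import Data.Sum.Base using (_⊎_; inj₁; inj₂; [_,_]′)
open import Data.Unit.Base using (⊤; tt)
open import Data.Vec.Base using (Vec; []; _∷_; lookup; tabulate; zipWith)
open import Data.Vec.Functional as Vector using (Vector; removeAt; updateAt)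
import Data.Vec.Functional.Properties as Vector
import Data.Vec.Properties as Vec
open import Function.Base using (const; _∘_)
open import Level using (0ℓ)
open import Relation.Binary.PropositionalEquality
open import Relation.Nullary.Decidable.Core
  using (Dec; yes; no; does; toSum; ¬?; decidable-stable; dec⇒maybe)
open import Relation.Nullary.Negation.Core using (¬_; contradiction)
open import Tactic.RingSolver using (solve-∀)
open import Tactic.RingSolver.Core.AlmostCommutativeRing using (AlmostCommutativeRing; fromCommutativeRing)
import Algebra.Properties.CommutativeMonoid.Sum ℤ.+-0-commutativeMonoid as ℤΣ
import Algebra.Properties.Semiring.Sum ℤ.+-*-semiring as ℤΣ′

-- Heights are integers because a facet fixes one of its coordinates to be an integer, while a
-- translation along (1,...,1) moves all coordinates equally: above a lattice point the surface
-- passes through a lattice point. D consists of the points of height at least 1. The threshold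
-- comes from the facet (x, i) itself, which contains x + (1,...,1) and x + eᵢ and so gives x and x
-- + eᵢ the heights 1 and 0. If the height drops from x to x + eᵢ between other values, the facet
-- responsible is a translate of (x, i) along (1,...,1), and D does not see the drop. The centre of
-- (x, i) is the test point because its half-integral coordinates leave no ambiguity: a facet of
-- type i met above it is exactly such a translate, and a facet of another type contains an edge
-- parallel to eᵢ, which forces equal heights. M⁻¹D is a down-set because a step upwards that enters
-- it would give E₁*(σ)(E) the value -1. Order on Cauchy reals is not decidable; excluded middle
-- makes it total, which gives floors and a first exit time from D.

-- Determinants: alternation, multilinearity and Cramer's rule over ℤ.

module Determinant where
  open import Data.Integer.Base using (_+_; _*_; -_; _^_)
  open ℤΣ using (sum)
  open ≡-Reasoning

  sum-zero : ∀ {n} {f : Vector ℤ n} → (∀ j → f j ≡ 0ℤ) → sum f ≡ 0ℤ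
  sum-zero {n} f≡0 = trans (ℤΣ.sum-cong-≗ f≡0) (ℤΣ.sum-replicate-zero n)

  *-distribˡ-sum : ∀ {n} a (f : Vector ℤ n) → a * sum f ≡ sum (λ j → a * f j)
  *-distribˡ-sum = ℤΣ′.*-distribˡ-sum

  sum-linear : ∀ {n} a b (f g : Vector ℤ n) →
               sum (λ j → a * f j + b * g j) ≡ a * sum f + b * sum g
  sum-linear a b f g = trans (ℤΣ.∑-distrib-+ (λ j → a * f j) (λ j → b * g j))
    (sym (cong₂ _+_ (*-distribˡ-sum a f) (*-distribˡ-sum b g)))

  sign : ∀ {n} → Fin n → ℤ
  sign j = -1ℤ ^ toℕ j

  minor : ∀ {n} → Matrix (suc n) → Fin (suc n) → Matrix n
  minor M j r = removeAt (M (suc r)) j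

  infixl 6 _[_]≔ʳ_

  _[_]≔ʳ_ : ∀ {n} {A : Set} → Vector A n → Fin n → A → Vector A n
  M [ k ]≔ʳ v = updateAt M k (const v)

  det-cong : ∀ {n} {M N : Matrix n} → (∀ i j → M i j ≡ N i j) → det M ≡ det N
  det-cong {zero}  M≡N = refl
  det-cong {suc n} {M} {N} M≡N = ℤΣ.sum-cong-≗ λ j →
    cong₂ (λ x y → sign j * x * y) (M≡N zero j)
      (det-cong {M = minor M j} {minor N j} λ r c → M≡N (suc r) (punchIn j c))

  minor-[]≔ : ∀ {n} (M : Matrix (suc n)) k v j →
              det (minor (M [ suc k ]≔ʳ v) j) ≡ det (minor M j [ k ]≔ʳ removeAt v j)
  minor-[]≔ M k v j = det-cong λ r c →
    cong (λ z → z c) (Vector.map-updateAt {f = λ row → removeAt row j} {const v} {const (removeAt v j)}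
                          (λ _ → refl) (M ∘ suc) k r)

  det-linear : ∀ {n} (M : Matrix n) k a b u v →
               det (M [ k ]≔ʳ λ j → a * u j + b * v j) ≡
               a * det (M [ k ]≔ʳ u) + b * det (M [ k ]≔ʳ v)
  det-linear {suc n} M zero a b u v = trans
    (ℤΣ.sum-cong-≗ λ j → expand (sign j) a b (u j) (v j) (det (minor M j)))
    (sum-linear a b (λ j → sign j * u j * det (minor M j)) (λ j → sign j * v j * det (minor M j)))
    where
    expand : ∀ s a b x y m → s * (a * x + b * y) * m ≡ a * (s * x * m) + b * (s * y * m)
    expand = solveℤ
  det-linear {suc n} M (suc k) a b u v = trans
    (ℤΣ.sum-cong-≗ λ j → begin
      sign j * M zero j * det (minor (M [ suc k ]≔ʳ λ i → a * u i + b * v i) j)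
        ≡⟨ cong (sign j * M zero j *_) (trans (minor-[]≔ M k _ j)
             (det-linear (minor M j) k a b (removeAt u j) (removeAt v j))) ⟩
      sign j * M zero j * (a * det (minor M j [ k ]≔ʳ removeAt u j)
                           + b * det (minor M j [ k ]≔ʳ removeAt v j))
        ≡⟨ expand (sign j) a b (M zero j) _ _ ⟩
      a * (sign j * M zero j * det (minor M j [ k ]≔ʳ removeAt u j))
        + b * (sign j * M zero j * det (minor M j [ k ]≔ʳ removeAt v j))
        ≡⟨ cong₂ (λ x y → a * (sign j * M zero j * x) + b * (sign j * M zero j * y))
             (sym (minor-[]≔ M k u j)) (sym (minor-[]≔ M k v j)) ⟩
      a * F u j + b * F v j ∎)
    (sum-linear a b (F u) (F v))
    where
    F : Vector ℤ (suc n) → Fin (suc n) → ℤ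
    F w j = sign j * M zero j * det (minor (M [ suc k ]≔ʳ w) j)
    expand : ∀ s a b m x y → s * m * (a * x + b * y) ≡ a * (s * m * x) + b * (s * m * y)
    expand = solveℤ

  -- `T j l` belongs to the ordered pair of distinct columns `j` and `punchIn j l`; the condition
  -- says that interchanging them negates `T`. The first component treats the pairs containing
  -- column zero, the recursion all others.
  Antisymmetric : ∀ n → (Fin (suc n) → Fin n → ℤ) → Set
  Antisymmetric zero    T = ⊤
  Antisymmetric (suc n) T =
    (∀ l → T (suc l) zero ≡ - T zero l) × Antisymmetric n (λ j l → T (suc j) (suc l))

  sum-antisymmetric : ∀ n {T} → Antisymmetric n T → sum (λ j → sum (T j)) ≡ 0ℤ
  sum-antisymmetric zero    _ = refl
  sum-antisymmetric (suc n) {T} (T₀ , T₊) = begin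
    sum (T zero) + sum (λ j → T (suc j) zero + sum (λ l → T (suc j) (suc l)))
      ≡⟨ cong (sum (T zero) +_) (ℤΣ.∑-distrib-+ (λ j → T (suc j) zero) (λ j → sum λ l → T (suc j) (suc l))) ⟩
    sum (T zero) + (sum (λ j → T (suc j) zero) + sum (λ j → sum (λ l → T (suc j) (suc l))))
      ≡⟨ cong (sum (T zero) +_) (cong (sum (λ j → T (suc j) zero) +_) (sum-antisymmetric n T₊)) ⟩
    sum (T zero) + (sum (λ j → T (suc j) zero) + 0ℤ)
      ≡⟨ cong (sum (T zero) +_) (ℤ.+-identityʳ _) ⟩
    sum (T zero) + sum (λ j → T (suc j) zero)
      ≡⟨ ℤΣ.∑-distrib-+ (T zero) (λ j → T (suc j) zero) ⟨
    sum (λ l → T zero l + T (suc l) zero)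
      ≡⟨ sum-zero (λ l → trans (cong (T zero l +_) (T₀ l)) (ℤ.+-inverseʳ (T zero l))) ⟩
    0ℤ ∎

  -- Φ g stands for the minor left after deleting two columns, g being the
  -- inclusion of the remaining ones.
  double-expansion-antisymmetric :
    ∀ n (v : Vector ℤ (suc (suc n))) (Φ : (Fin n → Fin (suc (suc n))) → ℤ) →
    (∀ g h → g ≗ h → Φ g ≡ Φ h) → (T : Fin (suc (suc n)) → Fin (suc n) → ℤ) →
    (∀ j l → T j l ≡ sign j * v j * (sign l * v (punchIn j l) * Φ (punchIn j ∘ punchIn l))) →
    Antisymmetric (suc n) T
  double-expansion-antisymmetric n v Φ Φ-cong T T≡ = pair , rest n v Φ Φ-cong T T≡
    where
    swap : ∀ s x y p → (-1ℤ * s) * x * (1ℤ * y * p) ≡ - (1ℤ * y * (s * x * p))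
    swap = solveℤ
    signs : ∀ s t x y p → (-1ℤ * s) * x * ((-1ℤ * t) * y * p) ≡ s * x * (t * y * p)
    signs = solveℤ

    pair : ∀ l → T (suc l) zero ≡ - T zero l
    pair l = begin
      T (suc l) zero
        ≡⟨ T≡ (suc l) zero ⟩
      sign (suc l) * v (suc l) * (1ℤ * v zero * Φ (punchIn (suc l) ∘ suc))
        ≡⟨ swap (sign l) (v (suc l)) (v zero) _ ⟩
      - (1ℤ * v zero * (sign l * v (suc l) * Φ (punchIn (suc l) ∘ suc)))
        ≡⟨ cong -_ (T≡ zero l) ⟨
      - T zero l ∎

    rest : ∀ n (v : Vector ℤ (suc (suc n))) (Φ : (Fin n → Fin (suc (suc n))) → ℤ) →
      (∀ g h → g ≗ h → Φ g ≡ Φ h) → (T : Fin (suc (suc n)) → Fin (suc n) → ℤ) →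
      (∀ j l → T j l ≡ sign j * v j * (sign l * v (punchIn j l) * Φ (punchIn j ∘ punchIn l))) →
      Antisymmetric n (λ j l → T (suc j) (suc l))
    rest zero    v Φ Φ-cong T T≡ = tt
    rest (suc n) v Φ Φ-cong T T≡ =
      double-expansion-antisymmetric n (v ∘ suc) (Φ ∘ lift) (λ g h g≗h → Φ-cong (lift g) (lift h) (lift-cong g h g≗h))
        (λ j l → T (suc j) (suc l))
        λ j l → trans (T≡ (suc j) (suc l)) (trans
          (signs (sign j) (sign l) (v (suc j)) (v (suc (punchIn j l)))
            (Φ (punchIn (suc j) ∘ punchIn (suc l))))
          (cong (λ p → sign j * v (suc j) * (sign l * v (suc (punchIn j l)) * p))
            (Φ-cong (punchIn (suc j) ∘ punchIn (suc l)) (lift (punchIn j ∘ punchIn l))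
              λ { zero → refl ; (suc c) → refl })))
      where
      -- When neither deleted column is column zero, that column survives in the minor; `lift` puts
      -- it back in front of the columns chosen by `g`.
      lift : (Fin n → Fin (suc (suc n))) → Fin (suc n) → Fin (suc (suc (suc n)))
      lift g zero    = zero
      lift g (suc c) = suc (g c)
      lift-cong : ∀ g h → g ≗ h → lift g ≗ lift h
      lift-cong g h g≗h zero    = refl
      lift-cong g h g≗h (suc c) = cong suc (g≗h c)

  -- Expanding along both rows gives a sum over ordered pairs of columns. As the rows agree,
  -- interchanging the two columns keeps the entries and the minor and reverses the sign.
  det-equal-first-rows : ∀ {n} (M : Matrix (suc (suc n))) →
                         (∀ c → M zero c ≡ M (suc zero) c) → det M ≡ 0ℤ
  det-equal-first-rows {n} M eq = trans
    (ℤΣ.sum-cong-≗ λ j → trans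
      (*-distribˡ-sum (sign j * M zero j) (λ l → sign l * minor M j zero l * det (minor (minor M j) l)))
      (ℤΣ.sum-cong-≗ λ l → cong (λ z → sign j * M zero j * (sign l * z * det (minor (minor M j) l)))
        (sym (eq (punchIn j l)))))
    (sum-antisymmetric (suc n) {T} (double-expansion-antisymmetric n (M zero) Φ
      (λ g h g≗h → det-cong {M = λ r c → M (suc (suc r)) (g c)} {λ r c → M (suc (suc r)) (h c)}
        λ r c → cong (M (suc (suc r))) (g≗h c))
      T λ _ _ → refl))
    where
    Φ : (Fin n → Fin (suc (suc n))) → ℤ
    Φ g = det λ r c → M (suc (suc r)) (g c)
    T : Fin (suc (suc n)) → Fin (suc n) → ℤ
    T j l = sign j * M zero j * (sign l * M zero (punchIn j l) * Φ (punchIn j ∘ punchIn l))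

  -- Exchanging rows `1F` and `K` brings the repeated row next to row zero. That the exchange
  -- negates the determinant is polarisation: `f` is bilinear in these rows and vanishes when they
  -- coincide, by the hypothesis applied to the minors along row zero.
  det-equal-first-row-step :
    ∀ {n} k → (∀ (N : Matrix (suc (suc n))) → (∀ c → N zero c ≡ N (suc k) c) → det N ≡ 0ℤ) →
    ∀ (M : Matrix (suc (suc (suc n)))) → (∀ c → M zero c ≡ M (suc (suc k)) c) → det M ≡ 0ℤ
  det-equal-first-row-step {n} k ih M eq = begin
    det M           ≡⟨ det-cong {M = M} {M [ 1F ]≔ʳ M 1F [ K ]≔ʳ M K} (λ r c → sym (cong (λ z → z c)
                         (trans (Vector.updateAt-id-local K (M [ 1F ]≔ʳ M 1F) refl r)
                                (Vector.updateAt-id-local 1F M refl r)))) ⟩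
    f (M 1F) (M K)  ≡⟨ skew (f (M 1F) (M 1F)) (f (M K) (M 1F)) (f (M 1F) (M K)) (f (M K) (M K)) bilinear ⟩
    - (f (M 1F) (M 1F) + f (M K) (M K) + f (M K) (M 1F))
      ≡⟨ cong -_ (cong₂ _+_ (cong₂ _+_ (f-diagonal (M 1F)) (f-diagonal (M K)))
           (det-equal-first-rows (M [ 1F ]≔ʳ M K [ K ]≔ʳ M 1F) eq)) ⟩
    0ℤ ∎
    where
    1F K : Fin (suc (suc (suc n)))
    1F = suc zero
    K  = suc (suc k)
    f : Vector ℤ _ → Vector ℤ _ → ℤ
    f u v = det (M [ 1F ]≔ʳ u [ K ]≔ʳ v)
    f-diagonal : ∀ u → f u u ≡ 0ℤ
    f-diagonal u = sum-zero λ j → trans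
      (cong (sign j * M zero j *_) (ih (minor (M [ 1F ]≔ʳ u [ K ]≔ʳ u) j) λ c → cong (λ z → z (punchIn j c)) (sym (Vector.updateAt-updates (suc k) ((M [ 1F ]≔ʳ u) ∘ suc)))))
      (ℤ.*-zeroʳ (sign j * M zero j))
    w : Vector ℤ _
    w c = 1ℤ * M 1F c + 1ℤ * M K c
    f-linearˡ : ∀ v → f w v ≡ 1ℤ * f (M 1F) v + 1ℤ * f (M K) v
    f-linearˡ v = begin
      f w v  ≡⟨ commute w ⟩
      _      ≡⟨ det-linear (M [ K ]≔ʳ v) 1F 1ℤ 1ℤ (M 1F) (M K) ⟩
      _      ≡⟨ cong₂ (λ x y → 1ℤ * x + 1ℤ * y) (commute (M 1F)) (commute (M K)) ⟨
      _      ∎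
      where
      commute : ∀ u → f u v ≡ det (M [ K ]≔ʳ v [ 1F ]≔ʳ u)
      commute u = det-cong {M = M [ 1F ]≔ʳ u [ K ]≔ʳ v} {M [ K ]≔ʳ v [ 1F ]≔ʳ u} λ r c → cong (λ z → z c) (Vector.updateAt-commutes K 1F (λ ()) M r)
    bilinear : 0ℤ ≡ 1ℤ * (1ℤ * f (M 1F) (M 1F) + 1ℤ * f (M K) (M 1F))
                  + 1ℤ * (1ℤ * f (M 1F) (M K) + 1ℤ * f (M K) (M K))
    bilinear = begin
      0ℤ     ≡⟨ f-diagonal w ⟨
      f w w  ≡⟨ det-linear (M [ 1F ]≔ʳ w) K 1ℤ 1ℤ (M 1F) (M K) ⟩
      _      ≡⟨ cong₂ (λ x y → 1ℤ * x + 1ℤ * y) (f-linearˡ (M 1F)) (f-linearˡ (M K)) ⟩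
      _      ∎
    skew : ∀ a b c d → 0ℤ ≡ 1ℤ * (1ℤ * a + 1ℤ * b) + 1ℤ * (1ℤ * c + 1ℤ * d) → c ≡ - (a + d + b)
    skew a b c d eq = begin
      c                  ≡⟨ regroup a b c d ⟩
      1ℤ * (1ℤ * a + 1ℤ * b) + 1ℤ * (1ℤ * c + 1ℤ * d) + - (a + d + b)
                         ≡⟨ cong (_+ - (a + d + b)) eq ⟨
      0ℤ + - (a + d + b) ≡⟨ ℤ.+-identityˡ _ ⟩
      - (a + d + b)      ∎
      where
      regroup : ∀ a b c d → c ≡ 1ℤ * (1ℤ * a + 1ℤ * b) + 1ℤ * (1ℤ * c + 1ℤ * d) + - (a + d + b)
      regroup = solveℤ

  det-equal-first-row : ∀ {n} (M : Matrix (suc n)) k → (∀ c → M zero c ≡ M (suc k) c) → det M ≡ 0ℤ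
  det-equal-first-row {suc n}       M zero    eq = det-equal-first-rows M eq
  det-equal-first-row {suc (suc n)} M (suc k) eq =
    det-equal-first-row-step k (λ N → det-equal-first-row N k) M eq

  det-equal-rows : ∀ {n} (M : Matrix n) i k → i ≢ k → (∀ c → M i c ≡ M k c) → det M ≡ 0ℤ
  det-equal-rows M zero    zero    i≢k eq = contradiction refl i≢k
  det-equal-rows M zero    (suc k) i≢k eq = det-equal-first-row M k eq
  det-equal-rows M (suc i) zero    i≢k eq = det-equal-first-row M i (sym ∘ eq)
  det-equal-rows M (suc i) (suc k) i≢k eq = sum-zero λ j → trans
    (cong (sign j * M zero j *_)
      (det-equal-rows (minor M j) i k (i≢k ∘ cong suc) (λ c → eq (punchIn j c))))
    (ℤ.*-zeroʳ (sign j * M zero j))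

  det-row-cong : ∀ {n} (M : Matrix n) k {u v : Vector ℤ n} → u ≗ v →
                 det (M [ k ]≔ʳ u) ≡ det (M [ k ]≔ʳ v)
  det-row-cong M k u≗v = det-cong (row-cong M k u≗v)
    where
    row-cong : ∀ {m n} (M : Fin m → Vector ℤ n) k {u v : Vector ℤ n} → u ≗ v →
               ∀ r c → (M [ k ]≔ʳ u) r c ≡ (M [ k ]≔ʳ v) r c
    row-cong M zero    u≗v zero    c = u≗v c
    row-cong M zero    u≗v (suc r) c = refl
    row-cong M (suc k) u≗v zero    c = refl
    row-cong M (suc k) u≗v (suc r) c = row-cong (M ∘ suc) k u≗v r c

  det-row-sum : ∀ {m n} (M : Matrix n) k (a : Vector ℤ m) (u : Fin m → Vector ℤ n) →
                det (M [ k ]≔ʳ λ c → sum λ j → a j * u j c) ≡ sum λ j → a j * det (M [ k ]≔ʳ u j)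
  -- The zero row is the combination 0·0 + 0·0, so linearity with zero coefficients evaluates the
  -- determinant to 0.
  det-row-sum {zero}  M k a u = det-linear M k 0ℤ 0ℤ (const 0ℤ) (const 0ℤ)
  det-row-sum {suc m} M k a u = begin
    det (M [ k ]≔ʳ λ c → a zero * u zero c + sum (λ j → a (suc j) * u (suc j) c))
      ≡⟨ det-row-cong M k (λ c → cong (a zero * u zero c +_) (sym (ℤ.*-identityˡ _))) ⟩
    det (M [ k ]≔ʳ λ c → a zero * u zero c + 1ℤ * sum (λ j → a (suc j) * u (suc j) c))
      ≡⟨ det-linear M k (a zero) 1ℤ (u zero) _ ⟩
    _ ≡⟨ cong (a zero * det (M [ k ]≔ʳ u zero) +_) (ℤ.*-identityˡ _) ⟩
    _ ≡⟨ cong (a zero * det (M [ k ]≔ʳ u zero) +_) (det-row-sum M k (a ∘ suc) (u ∘ suc)) ⟩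
    _ ∎

  lookup-0ᵛ : ∀ {d} (c : Fin d) → lookup 0ᵛ c ≡ 0ℤ
  lookup-0ᵛ c = Vec.lookup-replicate c 0ℤ

  sum-*-e : ∀ {d} (v : Vector ℤ d) i → sum (λ j → v j * lookup (e i) j) ≡ v i
  sum-*-e v zero = begin
    v zero * 1ℤ + sum (λ j → v (suc j) * lookup 0ᵛ j)
      ≡⟨ cong₂ _+_ (ℤ.*-identityʳ (v zero)) (sum-zero λ j →
           trans (cong (v (suc j) *_) (lookup-0ᵛ j)) (ℤ.*-zeroʳ (v (suc j)))) ⟩
    v zero + 0ℤ ≡⟨ ℤ.+-identityʳ (v zero) ⟩
    v zero ∎
  sum-*-e v (suc i) = trans
    (cong₂ _+_ (ℤ.*-zeroʳ (v zero)) (sum-*-e (v ∘ suc) i)) (ℤ.+-identityˡ (v (suc i)))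

  lookup-e-sym : ∀ {d} (i j : Fin d) → lookup (e i) j ≡ lookup (e j) i
  lookup-e-sym zero    zero    = refl
  lookup-e-sym zero    (suc j) = lookup-0ᵛ j
  lookup-e-sym (suc i) zero    = sym (lookup-0ᵛ i)
  lookup-e-sym (suc i) (suc j) = lookup-e-sym i j

  lookup-e-≡ : ∀ {d} (i : Fin d) → lookup (e i) i ≡ 1ℤ
  lookup-e-≡ i = Vec.lookup∘update i 0ᵛ 1ℤ

  lookup-e-≢ : ∀ {d} {i k : Fin d} → k ≢ i → lookup (e i) k ≡ 0ℤ
  lookup-e-≢ {k = k} k≢i = trans (Vec.lookup∘update′ k≢i 0ᵛ 1ℤ) (lookup-0ᵛ k)

  -- This is the identity M · adj M = det M · I, entry by entry: off the diagonal, row `l` occurs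
  -- twice.
  det-[]≔-row : ∀ {n} (M : Matrix n) k l → det (M [ k ]≔ʳ M l) ≡ det M * lookup (e l) k
  det-[]≔-row M k l with k Fin.≟ l
  ... | yes refl = begin
    det (M [ k ]≔ʳ M k)    ≡⟨ det-cong (λ r c → cong (λ z → z c) (Vector.updateAt-id-local k M refl r)) ⟩
    det M                  ≡⟨ ℤ.*-identityʳ (det M) ⟨
    det M * 1ℤ             ≡⟨ cong (det M *_) (lookup-e-≡ k) ⟨
    det M * lookup (e k) k ∎
  ... | no  k≢l = begin
    det (M [ k ]≔ʳ M l)
      ≡⟨ det-equal-rows (M [ k ]≔ʳ M l) k l k≢l (λ c → cong (λ z → z c)
           (trans (Vector.updateAt-updates k M) (sym (Vector.updateAt-minimal l k M (≢-sym k≢l))))) ⟩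
    0ℤ                     ≡⟨ ℤ.*-zeroʳ (det M) ⟨
    det M * 0ℤ             ≡⟨ cong (det M *_) (lookup-e-≢ k≢l) ⟨
    det M * lookup (e l) k ∎

  -- Cramer's rule, the cofactors being determinants with one row replaced by a
  -- basis vector.
  unimodular⇒surjective : ∀ {n} (M : Matrix n) → det M ≡ 1ℤ ⊎ det M ≡ -1ℤ → ∀ b → ∃[ u ] M · u ≡ b
  unimodular⇒surjective {n} M D≡±1 b = u , (begin
    M · u                 ≡⟨ Vec.tabulate-cong solves ⟩
    tabulate (lookup b)   ≡⟨ Vec.tabulate∘lookup b ⟩
    b                     ∎)
    where
    D = det M
    cofactor : Fin n → Fin n → ℤ
    cofactor k j = det (M [ k ]≔ʳ lookup (e j))
    u : Vec ℤ n
    -- Cramer's rule would divide by `D`; since `D * D` is 1, multiplying by `D` does the same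
    -- within ℤ.
    u = tabulate λ j → D * sum λ k → lookup b k * cofactor k j
    D*D≡1 : D * D ≡ 1ℤ
    D*D≡1 = [ (λ eq → cong₂ _*_ eq eq) , (λ eq → cong₂ _*_ eq eq) ]′ D≡±1
    expand : ∀ k l → sum (λ j → M l j * cofactor k j) ≡ D * lookup (e l) k
    expand k l = begin
      sum (λ j → M l j * cofactor k j)
        ≡⟨ det-row-sum M k (M l) (λ j → lookup (e j)) ⟨
      det (M [ k ]≔ʳ λ c → sum λ j → M l j * lookup (e j) c)
        ≡⟨ det-row-cong M k (λ c → trans
             (ℤΣ.sum-cong-≗ λ j → cong (M l j *_) (lookup-e-sym j c)) (sum-*-e (M l) c)) ⟩
      det (M [ k ]≔ʳ M l)
        ≡⟨ det-[]≔-row M k l ⟩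
      D * lookup (e l) k ∎
    pull : ∀ m d b c → m * (d * (b * c)) ≡ d * b * (m * c)
    pull = solveℤ
    push : ∀ d b c → d * b * (d * c) ≡ d * d * (b * c)
    push = solveℤ
    solves : ∀ l → sum (λ j → M l j * lookup u j) ≡ lookup b l
    solves l = begin
      sum (λ j → M l j * lookup u j)
        ≡⟨ ℤΣ.sum-cong-≗ (λ j → trans (cong (M l j *_) (Vec.lookup∘tabulate _ j))
             (trans (cong (M l j *_) (*-distribˡ-sum D (λ k → lookup b k * cofactor k j)))
               (trans (*-distribˡ-sum (M l j) (λ k → D * (lookup b k * cofactor k j)))
             (ℤΣ.sum-cong-≗ λ k → pull (M l j) D (lookup b k) (cofactor k j))))) ⟩
      sum (λ j → sum λ k → D * lookup b k * (M l j * cofactor k j))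
        ≡⟨ ℤΣ.∑-comm (λ j k → D * lookup b k * (M l j * cofactor k j)) ⟩
      sum (λ k → sum λ j → D * lookup b k * (M l j * cofactor k j))
        ≡⟨ ℤΣ.sum-cong-≗ (λ k → trans (sym (*-distribˡ-sum (D * lookup b k) (λ j → M l j * cofactor k j)))
             (trans (cong (D * lookup b k *_) (expand k l)) (push D (lookup b k) (lookup (e l) k)))) ⟩
      sum (λ k → D * D * (lookup b k * lookup (e l) k))
        ≡⟨ *-distribˡ-sum (D * D) (λ k → lookup b k * lookup (e l) k) ⟨
      D * D * sum (λ k → lookup b k * lookup (e l) k)
        ≡⟨ cong₂ _*_ D*D≡1 (sum-*-e (lookup b) l) ⟩
      1ℤ * lookup b l
        ≡⟨ ℤ.*-identityˡ (lookup b l) ⟩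
      lookup b l ∎

-- The dual map applied to a coboundary.

module DualMap where
  open import Data.Integer.Base using (_+_; _-_; _*_; -_)
  open ℤΣ using (sum)
  open ≡-Reasoning
  open Determinant

  vec-ext : ∀ {d} {A : Set} {x y : Vec A d} → (∀ k → lookup x k ≡ lookup y k) → x ≡ y
  vec-ext {x = x} {y} eq = trans (sym (Vec.tabulate∘lookup x))
    (trans (Vec.tabulate-cong eq) (Vec.tabulate∘lookup y))

  lookup-+ᵛ : ∀ {d} (x y : Vec ℤ d) k → lookup (x +ᵛ y) k ≡ lookup x k + lookup y k
  lookup-+ᵛ x y k = Vec.lookup-zipWith _+_ k x y

  lookup--ᵛ : ∀ {d} (x y : Vec ℤ d) k → lookup (x -ᵛ y) k ≡ lookup x k - lookup y k
  lookup--ᵛ x y k = Vec.lookup-zipWith _-_ k x y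

  +ᵛ-identityʳ : ∀ {d} (x : Vec ℤ d) → x +ᵛ 0ᵛ ≡ x
  +ᵛ-identityʳ x = Vec.zipWith-identityʳ ℤ.+-identityʳ x

  +ᵛ-swap : ∀ {d} (x y z : Vec ℤ d) → x +ᵛ (y +ᵛ z) ≡ x +ᵛ z +ᵛ y
  +ᵛ-swap x y z = trans (cong (x +ᵛ_) (Vec.zipWith-comm ℤ.+-comm y z))
                        (sym (Vec.zipWith-assoc ℤ.+-assoc x z y))

  +ᵛ--ᵛ-swap : ∀ {d} (x y z : Vec ℤ d) → x +ᵛ (y -ᵛ z) ≡ x -ᵛ z +ᵛ y
  +ᵛ--ᵛ-swap x y z = vec-ext λ k → begin
    lookup (x +ᵛ (y -ᵛ z)) k                 ≡⟨ lookup-+ᵛ x (y -ᵛ z) k ⟩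
    lookup x k + lookup (y -ᵛ z) k           ≡⟨ cong (lookup x k +_) (lookup--ᵛ y z k) ⟩
    lookup x k + (lookup y k - lookup z k)   ≡⟨ arith (lookup x k) (lookup y k) (lookup z k) ⟩
    lookup x k - lookup z k + lookup y k     ≡⟨ cong (_+ lookup y k) (lookup--ᵛ x z k) ⟨
    lookup (x -ᵛ z) k + lookup y k           ≡⟨ lookup-+ᵛ (x -ᵛ z) y k ⟨
    lookup (x -ᵛ z +ᵛ y) k                   ∎
    where
    arith : ∀ a b c → a + (b - c) ≡ a - c + b
    arith = solveℤ

  -ᵛ-+ᵛ : ∀ {d} (x y : Vec ℤ d) → x -ᵛ y +ᵛ y ≡ x
  -ᵛ-+ᵛ x y = vec-ext λ k → trans (lookup-+ᵛ (x -ᵛ y) y k)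
    (trans (cong (_+ lookup y k) (lookup--ᵛ x y k)) (arith (lookup x k) (lookup y k)))
    where
    arith : ∀ a b → a - b + b ≡ a
    arith = solveℤ

  ·-+ᵛ-e : ∀ {d} (M : Matrix d) x i → M · (x +ᵛ e i) ≡ M · x +ᵛ tabulate (λ k → M k i)
  ·-+ᵛ-e M x i = vec-ext λ k → begin
    lookup (M · (x +ᵛ e i)) k
      ≡⟨ Vec.lookup∘tabulate _ k ⟩
    sum (λ j → M k j * lookup (x +ᵛ e i) j)
      ≡⟨ ℤΣ.sum-cong-≗ (λ j → trans (cong (M k j *_) (lookup-+ᵛ x (e i) j))
           (ℤ.*-distribˡ-+ (M k j) (lookup x j) (lookup (e i) j))) ⟩
    sum (λ j → M k j * lookup x j + M k j * lookup (e i) j)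
      ≡⟨ ℤΣ.∑-distrib-+ (λ j → M k j * lookup x j) _ ⟩
    sum (λ j → M k j * lookup x j) + sum (λ j → M k j * lookup (e i) j)
      ≡⟨ cong₂ _+_ (sym (Vec.lookup∘tabulate _ k))
                   (trans (sum-*-e (M k) i) (sym (Vec.lookup∘tabulate _ k))) ⟩
    lookup (M · x) k + lookup (tabulate (λ k → M k i)) k
      ≡⟨ lookup-+ᵛ (M · x) _ k ⟨
    lookup (M · x +ᵛ tabulate (λ k → M k i)) k ∎

  module _ {d} (E : SteppedFunction d) (χ : Vec ℤ d → ℤ)
           (E≡ : ∀ x i → E x i ≡ χ x - χ (x +ᵛ e i)) where

    -- The prefix matters only through its sum with the base point, so the first letter of a word
    -- can be moved from all prefixes into the base point.
    term-cong : ∀ {y y′ p p′} → y +ᵛ abelianize p ≡ y′ +ᵛ abelianize p′ →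
                ∀ l → term E y p l ≡ term E y′ p′ l
    term-cong eq (gen j)   = cong (λ z → E z j) eq
    term-cong eq (gen⁻¹ j) = cong (λ z → - E (z -ᵛ e j) j) eq

    -- The prefixes of `w` trace a lattice path from `y`, and each letter contributes χ at the
    -- vertex it leaves minus χ at the vertex it enters. For an inverse letter this is what the
    -- shift by -eⱼ and the minus sign in the dual map achieve.
    telescope : ∀ w y →
      sum {length w} (λ n → term E y (take (toℕ n) w) (List.lookup w n)) ≡
      χ y - χ (y +ᵛ abelianize w)
    telescope [] y = begin
      0ℤ                ≡⟨ ℤ.+-inverseʳ (χ y) ⟨
      χ y - χ y         ≡⟨ cong (λ z → χ y - χ z) (+ᵛ-identityʳ y) ⟨
      χ y - χ (y +ᵛ 0ᵛ) ∎
    telescope (gen j ∷ w) y = begin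
      E (y +ᵛ 0ᵛ) j + sum (λ n → term E y (gen j ∷ take (toℕ n) w) (List.lookup w n))
        ≡⟨ cong₂ _+_ (trans (cong (λ z → E z j) (+ᵛ-identityʳ y)) (E≡ y j))
             (trans (ℤΣ.sum-cong-≗ λ n → term-cong {y} {y +ᵛ e j} {gen j ∷ take (toℕ n) w} {take (toℕ n) w}
                (+ᵛ-swap y (abelianize (take (toℕ n) w)) (e j)) (List.lookup w n)) (telescope w (y +ᵛ e j))) ⟩
      χ y - χ (y +ᵛ e j) + (χ (y +ᵛ e j) - χ (y +ᵛ e j +ᵛ abelianize w))
        ≡⟨ arith (χ y) (χ (y +ᵛ e j)) _ ⟩
      χ y - χ (y +ᵛ e j +ᵛ abelianize w)
        ≡⟨ cong (λ z → χ y - χ z) (+ᵛ-swap y (abelianize w) (e j)) ⟨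
      χ y - χ (y +ᵛ (abelianize w +ᵛ e j)) ∎
      where
      arith : ∀ a b c → a - b + (b - c) ≡ a - c
      arith = solveℤ
    telescope (gen⁻¹ j ∷ w) y = begin
      - E (y +ᵛ 0ᵛ -ᵛ e j) j + sum (λ n → term E y (gen⁻¹ j ∷ take (toℕ n) w) (List.lookup w n))
        ≡⟨ cong₂ _+_ (cong -_ (trans (cong (λ z → E (z -ᵛ e j) j) (+ᵛ-identityʳ y))
               (trans (E≡ (y -ᵛ e j) j) (cong (λ z → χ (y -ᵛ e j) - χ z) (-ᵛ-+ᵛ y (e j))))))
             (trans (ℤΣ.sum-cong-≗ λ n → term-cong {y} {y -ᵛ e j} {gen⁻¹ j ∷ take (toℕ n) w} {take (toℕ n) w}
                (+ᵛ--ᵛ-swap y (abelianize (take (toℕ n) w)) (e j)) (List.lookup w n)) (telescope w (y -ᵛ e j))) ⟩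
      - (χ (y -ᵛ e j) - χ y) + (χ (y -ᵛ e j) - χ (y -ᵛ e j +ᵛ abelianize w))
        ≡⟨ arith (χ (y -ᵛ e j)) (χ y) _ ⟩
      χ y - χ (y -ᵛ e j +ᵛ abelianize w)
        ≡⟨ cong (λ z → χ y - χ z) (+ᵛ--ᵛ-swap y (abelianize w) (e j)) ⟨
      χ y - χ (y +ᵛ (abelianize w -ᵛ e j)) ∎
      where
      arith : ∀ a b c → - (a - b) + (a - c) ≡ b - c
      arith = solveℤ

    -- The path along σ(i) ends at Mx + f(σ(i)), and f(σ(i)) is the i-th column of M, so the end
    -- point is M(x + eᵢ).
    E₁*-coboundary : ∀ (σ : Morphism d) x i →
      E₁* σ E x i ≡ χ (incidence σ · x) - χ (incidence σ · (x +ᵛ e i))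
    E₁*-coboundary σ x i = trans (telescope (image σ i) (incidence σ · x))
      (cong (λ z → χ (incidence σ · x) - χ z) (sym (trans (·-+ᵛ-e (incidence σ) x i)
        (cong (incidence σ · x +ᵛ_) (Vec.tabulate∘lookup (abelianize (image σ i)))))))

-- Order on the Cauchy reals and its comparison with ℤ.

module RealOrder where
  open import Data.Rational.Base using (_+_; _-_; -_; _*_; _/_; _<_; _≤_; ∣_∣; toℚᵘ; mkℚ)
  open import Data.Rational.Unnormalised.Base using (mkℚᵘ; *≡*; *≤*)

  ℚ-ring : AlmostCommutativeRing 0ℓ 0ℓ
  ℚ-ring = fromCommutativeRing ℚ.+-*-commutativeRing λ q → dec⇒maybe (0ℚ ℚ.≟ q)

  -- Inequalities are transported along equal differences; the remaining
  -- equation between differences is a ring identity.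
  <-by : ∀ {a b u v} → a < b → v - u ≡ b - a → u < v
  <-by {a} {b} {u} {v} a<b eq = subst₂ _<_ (left a u)
    (trans (right a b u) (trans (cong (_+ u) (sym eq)) (regroup v u)))
    (ℚ.+-monoˡ-< (u - a) a<b)
    where
    left : ∀ a u → a + (u - a) ≡ u
    left = solve-∀ ℚ-ring
    right : ∀ a b u → b + (u - a) ≡ (b - a) + u
    right = solve-∀ ℚ-ring
    regroup : ∀ v u → (v - u) + u ≡ v
    regroup = solve-∀ ℚ-ring

  ½* : ∀ {ε} → 0ℚ < ε → 0ℚ < ½ * ε
  ½* {ε} 0<ε = subst (_< ½ * ε) (ℚ.*-zeroʳ ½) (ℚ.*-monoʳ-<-pos ½ 0<ε)

  ½*+½* : ∀ x → ½ * x + ½ * x ≡ x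
  ½*+½* = solve-∀ ℚ-ring

  p≤∣p∣ : ∀ p → p ≤ ∣ p ∣
  p≤∣p∣ p with ℚ.≤-total 0ℚ p
  ... | inj₁ 0≤p = ℚ.≤-reflexive (sym (ℚ.0≤p⇒∣p∣≡p 0≤p))
  ... | inj₂ p≤0 = ℚ.≤-trans p≤0 (ℚ.0≤∣p∣ p)

  private variable
    x y z u v x′ y′ : ℝ

  ≤-by : x ≤ᴿ y → (∀ n → seq v n - seq u n ≡ seq y n - seq x n) → u ≤ᴿ v
  ≤-by {x} {y} {v} {u} x≤y eq ε 0<ε with N , p ← x≤y ε 0<ε =
    N , λ n N≤n → <-by (p n N≤n) (trans (shift (seq v n) ε (seq u n))
          (trans (cong (_+ ε) (eq n)) (sym (shift (seq y n) ε (seq x n)))))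
    where
    shift : ∀ a e b → (a + e) - b ≡ (a - b) + e
    shift = solve-∀ ℚ-ring

  +-mono-≤ᴿ : x ≤ᴿ y → x′ ≤ᴿ y′ → x +ᴿ x′ ≤ᴿ y +ᴿ y′
  +-mono-≤ᴿ {x} {y} {x′} {y′} p q ε 0<ε
    with M , p ← p (½ * ε) (½* 0<ε) | N , q ← q (½ * ε) (½* 0<ε) =
    M ℕ.⊔ N , λ n M⊔N≤n → <-by
      (ℚ.+-mono-< (p n (ℕ.m⊔n≤o⇒m≤o M N M⊔N≤n)) (q n (ℕ.m⊔n≤o⇒n≤o M N M⊔N≤n)))
      (cong (_- (seq x n + seq x′ n)) (trans (cong (seq y n + seq y′ n +_) (sym (½*+½* ε)))
        (interchange (seq y n) (seq y′ n) (½ * ε) (½ * ε))))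
    where
    interchange : ∀ a b c d → (a + b) + (c + d) ≡ (a + c) + (b + d)
    interchange = solve-∀ ℚ-ring

  ≗⇒≤ : (∀ n → seq x n ≡ seq y n) → x ≤ᴿ y
  ≗⇒≤ {x} {y} eq ε 0<ε = 0 , λ n _ →
    subst₂ _<_ (trans (ℚ.+-identityʳ (seq y n)) (sym (eq n))) refl (ℚ.+-monoʳ-< (seq y n) 0<ε)

  ≗⇒≈ : (∀ n → seq x n ≡ seq y n) → x ≈ᴿ y
  ≗⇒≈ {x} {y} eq = ≗⇒≤ {x} {y} eq , ≗⇒≤ {y} {x} (λ n → sym (eq n))

  ≤ᴿ-refl : x ≤ᴿ x
  ≤ᴿ-refl {x} = ≗⇒≤ {x} {x} λ _ → refl

  ≤ᴿ-trans : x ≤ᴿ y → y ≤ᴿ z → x ≤ᴿ z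
  ≤ᴿ-trans {x} {y} {z} x≤y y≤z = ≤-by {x +ᴿ y} {y +ᴿ z} {z} {x} (+-mono-≤ᴿ {x} {y} {y} {z} x≤y y≤z)
    λ n → chain (seq x n) (seq y n) (seq z n)
    where
    chain : ∀ a b c → c - a ≡ (b + c) - (a + b)
    chain = solve-∀ ℚ-ring

  ≈ᴿ-sym : x ≈ᴿ y → y ≈ᴿ x
  ≈ᴿ-sym (x≤y , y≤x) = y≤x , x≤y

  ≈ᴿ-trans : x ≈ᴿ y → y ≈ᴿ z → x ≈ᴿ z
  ≈ᴿ-trans {x} {y} {z} (x≤y , y≤x) (y≤z , z≤y) =
    ≤ᴿ-trans {x} {y} {z} x≤y y≤z , ≤ᴿ-trans {z} {y} {x} z≤y y≤x

  <⇒≤ : x <ᴿ y → x ≤ᴿ y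
  <⇒≤ {x} {y} (η , 0<η , N , p) ε 0<ε = N , λ n N≤n → begin-strict
    seq x n        ≡⟨ ℚ.+-identityʳ (seq x n) ⟨
    seq x n + 0ℚ   <⟨ ℚ.+-monoʳ-< (seq x n) 0<η ⟩
    seq x n + η    <⟨ p n N≤n ⟩
    seq y n        ≡⟨ ℚ.+-identityʳ (seq y n) ⟨
    seq y n + 0ℚ   <⟨ ℚ.+-monoʳ-< (seq y n) 0<ε ⟩
    seq y n + ε    ∎
    where open ℚ.≤-Reasoning

  ≤-<-trans : x ≤ᴿ y → y <ᴿ z → x <ᴿ z
  ≤-<-trans {x} {y} {z} x≤y (η , 0<η , N , q) with M , p ← x≤y (½ * η) (½* 0<η) =
    ½ * η , ½* 0<η , M ℕ.⊔ N , λ n M⊔N≤n → begin-strict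
      seq x n + ½ * η           <⟨ ℚ.+-monoˡ-< (½ * η) (p n (ℕ.m⊔n≤o⇒m≤o M N M⊔N≤n)) ⟩
      seq y n + ½ * η + ½ * η   ≡⟨ ℚ.+-assoc (seq y n) (½ * η) (½ * η) ⟩
      seq y n + (½ * η + ½ * η) ≡⟨ cong (seq y n +_) (½*+½* η) ⟩
      seq y n + η               <⟨ q n (ℕ.m⊔n≤o⇒n≤o M N M⊔N≤n) ⟩
      seq z n                   ∎
    where open ℚ.≤-Reasoning

  *ᴿ-mono-≤ : ∀ c .{{_ : ℚ.Positive c}} → x ≤ᴿ y → c *ᴿ x ≤ᴿ c *ᴿ y
  *ᴿ-mono-≤ {x} {y} c x≤y ε 0<ε = let N , p = x≤y (1/c * ε) 0<1/c*ε in
    N , λ n N≤n → begin-strict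
      c * seq x n                  <⟨ ℚ.*-monoʳ-<-pos c (p n N≤n) ⟩
      c * (seq y n + 1/c * ε)      ≡⟨ expand c (seq y n) 1/c ε ⟩
      c * seq y n + (c * 1/c) * ε  ≡⟨ cong (λ q → c * seq y n + q * ε) (ℚ.*-inverseʳ c) ⟩
      c * seq y n + 1ℚ * ε         ≡⟨ cong (c * seq y n +_) (ℚ.*-identityˡ ε) ⟩
      c * seq y n + ε              ∎
    where
    open ℚ.≤-Reasoning
    instance
      c≢0 : ℚ.NonZero c
      c≢0 = ℚ.pos⇒nonZero c
    1/c : ℚ
    1/c = ℚ.1/ c
    instance
      1/c-pos : ℚ.Positive 1/c
      1/c-pos = ℚ.1/pos⇒pos c
    0<1/c*ε : 0ℚ < 1/c * ε
    0<1/c*ε = subst (_< 1/c * ε) (ℚ.*-zeroʳ 1/c) (ℚ.*-monoʳ-<-pos 1/c 0<ε)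
    expand : ∀ c b d e → c * (b + d * e) ≡ c * b + (c * d) * e
    expand = solve-∀ ℚ-ring

  /1≃ : ∀ a → toℚᵘ (a / 1) ℚᵘ.≃ mkℚᵘ a 0
  /1≃ a = ℚ.toℚᵘ-fromℚᵘ (mkℚᵘ a 0)

  /1-homo-+ : ∀ a b → (a ℤ.+ b) / 1 ≡ a / 1 + b / 1
  /1-homo-+ a b = ℚ.toℚᵘ-injective (begin
    toℚᵘ ((a ℤ.+ b) / 1)            ≈⟨ /1≃ (a ℤ.+ b) ⟩
    mkℚᵘ (a ℤ.+ b) 0                ≈⟨ *≡* (arith a b) ⟩
    mkℚᵘ a 0 ℚᵘ.+ mkℚᵘ b 0          ≈⟨ ℚᵘ.+-cong (/1≃ a) (/1≃ b) ⟨
    toℚᵘ (a / 1) ℚᵘ.+ toℚᵘ (b / 1)  ≈⟨ ℚ.toℚᵘ-homo-+ (a / 1) (b / 1) ⟨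
    toℚᵘ (a / 1 + b / 1)            ∎)
    where
    open ℚᵘ.≃-Reasoning
    arith : ∀ a b → (a ℤ.+ b) ℤ.* ℤ.1ℤ ≡ (a ℤ.* ℤ.1ℤ ℤ.+ b ℤ.* ℤ.1ℤ) ℤ.* ℤ.1ℤ
    arith = solveℤ

  /1-homo-neg : ∀ a → (ℤ.- a) / 1 ≡ - (a / 1)
  /1-homo-neg a = begin
    (ℤ.- a) / 1                         ≡⟨ regroup ((ℤ.- a) / 1) (a / 1) ⟩
    (ℤ.- a) / 1 + a / 1 + - (a / 1)     ≡⟨ cong (_+ - (a / 1)) (/1-homo-+ (ℤ.- a) a) ⟨
    (ℤ.- a ℤ.+ a) / 1 + - (a / 1)       ≡⟨ cong (λ z → z / 1 + - (a / 1)) (ℤ.+-inverseˡ a) ⟩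
    0ℚ + - (a / 1)                      ≡⟨ ℚ.+-identityˡ _ ⟩
    - (a / 1)                           ∎
    where
    open ≡-Reasoning
    regroup : ∀ x y → x ≡ x + y + - y
    regroup = solve-∀ ℚ-ring

  /1-mono-≤ : ∀ {a b} → a ℤ.≤ b → a / 1 ≤ b / 1
  /1-mono-≤ {a} {b} a≤b = ℚ.toℚᵘ-cancel-≤ (begin
    toℚᵘ (a / 1)  ≃⟨ /1≃ a ⟩
    mkℚᵘ a 0      ≤⟨ *≤* (ℤ.*-monoʳ-≤-nonNeg ℤ.1ℤ a≤b) ⟩
    mkℚᵘ b 0      ≃⟨ /1≃ b ⟨
    toℚᵘ (b / 1)  ∎)
    where open ℚᵘ.≤-Reasoning

  fromℤ-mono-≤ : ∀ {a b} → a ℤ.≤ b → fromℤ a ≤ᴿ fromℤ b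
  fromℤ-mono-≤ {a} {b} a≤b ε 0<ε = 0 , λ _ _ → begin-strict
    a / 1        ≤⟨ /1-mono-≤ a≤b ⟩
    b / 1        ≡⟨ ℚ.+-identityʳ (b / 1) ⟨
    b / 1 + 0ℚ   <⟨ ℚ.+-monoʳ-< (b / 1) 0<ε ⟩
    b / 1 + ε    ∎
    where open ℚ.≤-Reasoning

  -- Testing at ε = 1 is enough, since integers with b < a satisfy b + 1 ≤ a.
  fromℤ-cancel-≤ : ∀ {a b} → fromℤ a ≤ᴿ fromℤ b → a ℤ.≤ b
  fromℤ-cancel-≤ {a} {b} a≤b with a ℤ.≤? b | a≤b 1ℚ (ℚ.positive⁻¹ 1ℚ)
  ... | yes p | _     = p
  ... | no ¬p | N , q = contradiction (ℚ.<-≤-trans (q N ℕ.≤-refl) b+1≤a) (ℚ.<-irrefl refl)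
    where
    b+1≤a : b / 1 + 1ℚ ≤ a / 1
    b+1≤a = subst (_≤ a / 1) (/1-homo-+ b ℤ.1ℤ)
      (/1-mono-≤ (subst (ℤ._≤ a) (ℤ.+-comm ℤ.1ℤ b) (ℤ.i<j⇒suc[i]≤j (ℤ.≰⇒> ¬p))))

  ≤∣numerator∣ : ∀ q → ∃[ K ] q ≤ K / 1
  ≤∣numerator∣ q@(mkℚ n d _) = ℤ.+ ℤ.∣ n ∣ , ℚ.toℚᵘ-cancel-≤ (begin
    mkℚᵘ n d                   ≤⟨ *≤* n≤ ⟩
    mkℚᵘ (ℤ.+ ℤ.∣ n ∣) 0       ≃⟨ /1≃ (ℤ.+ ℤ.∣ n ∣) ⟨
    toℚᵘ ((ℤ.+ ℤ.∣ n ∣) / 1)   ∎)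
    where
    open ℚᵘ.≤-Reasoning
    n≤ : n ℤ.* ℤ.1ℤ ℤ.≤ ℤ.+ ℤ.∣ n ∣ ℤ.* ℤ.+ suc d
    i≤∣i∣ : ∀ i → i ℤ.≤ ℤ.+ ℤ.∣ i ∣
    i≤∣i∣ (ℤ.+ _)    = ℤ.≤-refl
    i≤∣i∣ ℤ.-[1+ _ ] = ℤ.-≤+
    n≤ = ℤ.≤-trans (ℤ.≤-reflexive (ℤ.*-identityʳ n)) (ℤ.≤-trans (i≤∣i∣ n)
      (subst (ℤ.+ ℤ.∣ n ∣ ℤ.≤_) (ℤ.pos-* ℤ.∣ n ∣ (suc d)) (ℤ.+≤+ (ℕ.m≤m*n ℤ.∣ n ∣ (suc d)))))

  archimedean : ∀ x → ∃[ K ] x ≤ᴿ fromℤ K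
  archimedean x =
    let N , close = cauchy x 1ℚ (ℚ.positive⁻¹ 1ℚ)
        K , p = ≤∣numerator∣ (seq x N + 1ℚ)
    in K , λ ε 0<ε → N , λ n N≤n → begin-strict
      seq x n                         ≡⟨ regroup (seq x n) (seq x N) ⟩
      seq x N + (seq x n - seq x N)   <⟨ ℚ.+-monoʳ-< (seq x N) (ℚ.≤-<-trans (p≤∣p∣ (seq x n - seq x N)) (close n N N≤n ℕ.≤-refl)) ⟩
      seq x N + 1ℚ                    ≤⟨ p ⟩
      K / 1                           ≡⟨ ℚ.+-identityʳ (K / 1) ⟨
      K / 1 + 0ℚ                      <⟨ ℚ.+-monoʳ-< (K / 1) 0<ε ⟩
      K / 1 + ε                       ∎
    where
    open ℚ.≤-Reasoning
    regroup : ∀ a b → a ≡ b + (a - b)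
    regroup = solve-∀ ℚ-ring

  archimedean′ : ∀ x → ∃[ K ] fromℤ K ≤ᴿ x
  archimedean′ x = let K , p = archimedean (-ᴿ x) in ℤ.- K ,
    ≤-by { -ᴿ x} {fromℤ K} {x} {fromℤ (ℤ.- K)} p
      λ n → trans (cong (λ z → seq x n - z) (/1-homo-neg K)) (flip-sides (seq x n) (K / 1))
    where
    flip-sides : ∀ a b → a - (- b) ≡ b - (- a)
    flip-sides = solve-∀ ℚ-ring

  module _ (em : ExcludedMiddle 0ℓ) where

    ≰⇒frequently : ¬ x ≤ᴿ y →
      Σ[ ε ∈ ℚ ] 0ℚ < ε × (∀ N → ∃[ n ] N ℕ.≤ n × seq y n + ε ≤ seq x n)
    ≰⇒frequently {x} {y} x≰y with em {Σ[ ε ∈ ℚ ] 0ℚ < ε × (∀ N → ∃[ n ] N ℕ.≤ n × seq y n + ε ≤ seq x n)}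
    ... | yes p = p
    ... | no ¬p = contradiction x≤y x≰y
      where
      x≤y : x ≤ᴿ y
      x≤y ε 0<ε with em {∃[ N ] ∀ n → N ℕ.≤ n → seq x n < seq y n + ε}
      ... | yes q = q
      ... | no ¬q = contradiction (ε , 0<ε , often) ¬p
        where
        often : ∀ N → ∃[ n ] N ℕ.≤ n × seq y n + ε ≤ seq x n
        often N with em {∃[ n ] N ℕ.≤ n × seq y n + ε ≤ seq x n}
        ... | yes r = r
        ... | no ¬r = contradiction (N , λ n N≤n → ℚ.≰⇒> λ le → ¬r (n , N≤n , le)) ¬q

    -- The failure of x ≤ y provides a gap ε only at arbitrarily late indices. From there to any
    -- other late index each sequence moves by less than ε/2, so the gap cannot change sign.
    ≰⇒≥ : ¬ x ≤ᴿ y → y ≤ᴿ x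
    ≰⇒≥ {x} {y} x≰y ε′ 0<ε′ =
      let ε , 0<ε , often = ≰⇒frequently {x} {y} x≰y
          M , p = cauchy x (½ * ε) (½* 0<ε)
          N , q = cauchy y (½ * ε) (½* 0<ε)
          n , M⊔N≤n , y+ε≤x = often (M ℕ.⊔ N)
      in M ℕ.⊔ N , λ m M⊔N≤m →
        let xₙ-xₘ<½ε = ℚ.≤-<-trans (p≤∣p∣ (seq x n - seq x m))
                         (p n m (ℕ.m⊔n≤o⇒m≤o M N M⊔N≤n) (ℕ.m⊔n≤o⇒m≤o M N M⊔N≤m))
            yₘ-yₙ<½ε = ℚ.≤-<-trans (p≤∣p∣ (seq y m - seq y n))
                         (q m n (ℕ.m⊔n≤o⇒n≤o M N M⊔N≤m) (ℕ.m⊔n≤o⇒n≤o M N M⊔N≤n))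
        in <-by (ℚ.+-mono-< (ℚ.+-mono-<-≤ (ℚ.+-mono-< xₙ-xₘ<½ε yₘ-yₙ<½ε) y+ε≤x) 0<ε′)
             (trans (regroup (seq x m) ε′ (seq y m) (seq x n) (seq y n) ε)
                    (cong (λ h → ((h + seq x n) + ε′) - ((((seq x n - seq x m) + (seq y m - seq y n)) + (seq y n + ε)) + 0ℚ)) (sym (½*+½* ε))))
      where
      regroup : ∀ xₘ ε′ yₘ xₙ yₙ ε → (xₘ + ε′) - yₘ ≡
        ((ε + xₙ) + ε′) - ((((xₙ - xₘ) + (yₘ - yₙ)) + (yₙ + ε)) + 0ℚ)
      regroup = solve-∀ ℚ-ring

-- Orthogonal projection as translation along (1,...,1).

module Projection where
  open import Data.Rational.Base using (_+_; _-_; -_; _*_; _/_; toℚᵘ)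
  open import Data.Rational.Unnormalised.Base using (mkℚᵘ; *≡*)
  open RealOrder

  infixl 6 _+¹_

  _+¹_ : ∀ {d} → ℝ^ d → ℝ → ℝ^ d
  (p +¹ t) k = p k +ᴿ t

  sumᴿ-+¹ : ∀ {d} (p : ℝ^ d) t n → seq (sumᴿ (p +¹ t)) n ≡ seq (sumᴿ p) n + (ℤ.+ d / 1) * seq t n
  sumᴿ-+¹ {zero} p t n = sym (trans (ℚ.+-identityˡ _) (ℚ.*-zeroˡ (seq t n)))
  sumᴿ-+¹ {suc d} p t n = begin
    seq (p zero) n + seq t n + seq (sumᴿ ((λ k → p (suc k)) +¹ t)) n
      ≡⟨ cong (seq (p zero) n + seq t n +_) (sumᴿ-+¹ (λ k → p (suc k)) t n) ⟩
    seq (p zero) n + seq t n + (seq (sumᴿ λ k → p (suc k)) n + (ℤ.+ d / 1) * seq t n)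
      ≡⟨ regroup (seq (p zero) n) (seq t n) _ (ℤ.+ d / 1) ⟩
    seq (p zero) n + seq (sumᴿ λ k → p (suc k)) n + (1ℚ + ℤ.+ d / 1) * seq t n
      ≡⟨ cong (λ c → seq (p zero) n + seq (sumᴿ λ k → p (suc k)) n + c * seq t n) (/1-homo-+ ℤ.1ℤ (ℤ.+ d)) ⟨
    seq (p zero) n + seq (sumᴿ λ k → p (suc k)) n + (ℤ.+ suc d / 1) * seq t n ∎
    where
    open ≡-Reasoning
    regroup : ∀ a t s c → a + t + (s + c * t) ≡ a + s + (1ℚ + c) * t
    regroup = solve-∀ ℚ-ring

  1/d*d : ∀ d .{{_ : NonZero d}} → (ℤ.+ 1 / d) * (ℤ.+ d / 1) ≡ 1ℚ
  1/d*d (suc d) = ℚ.toℚᵘ-injective (begin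
    toℚᵘ ((ℤ.+ 1 / suc d) * (ℤ.+ suc d / 1))          ≈⟨ ℚ.toℚᵘ-homo-* (ℤ.+ 1 / suc d) (ℤ.+ suc d / 1) ⟩
    toℚᵘ (ℤ.+ 1 / suc d) ℚᵘ.* toℚᵘ (ℤ.+ suc d / 1)    ≈⟨ ℚᵘ.*-cong (ℚ.toℚᵘ-fromℚᵘ (mkℚᵘ (ℤ.+ 1) d)) (/1≃ (ℤ.+ suc d)) ⟩
    mkℚᵘ (ℤ.+ 1) d ℚᵘ.* mkℚᵘ (ℤ.+ suc d) 0            ≈⟨ *≡* (arith (ℤ.+ suc d)) ⟩
    mkℚᵘ ℤ.1ℤ 0                                       ∎)
    where
    open ℚᵘ.≃-Reasoning
    arith : ∀ x → ℤ.1ℤ ℤ.* x ℤ.* ℤ.1ℤ ≡ ℤ.1ℤ ℤ.* (x ℤ.* ℤ.1ℤ)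
    arith = solveℤ

  sumᴿ-mono-≤ : ∀ {d} {p q : ℝ^ d} → (∀ k → p k ≤ᴿ q k) → sumᴿ p ≤ᴿ sumᴿ q
  sumᴿ-mono-≤ {zero}  _   = ≤ᴿ-refl {0ᴿ}
  sumᴿ-mono-≤ {suc d} {p} {q} p≤q = +-mono-≤ᴿ {p zero} {q zero} {sumᴿ λ k → p (suc k)} {sumᴿ λ k → q (suc k)}
    (p≤q zero) (sumᴿ-mono-≤ {d} {λ k → p (suc k)} {λ k → q (suc k)} (λ k → p≤q (suc k)))

  module _ {d} .{{nz : NonZero d}} where

    mean : ℝ^ d → ℝ
    mean p = (ℤ.+ 1 / d) *ᴿ sumᴿ p

    π-≋⇒deviations : ∀ {p q} → π p ≋ π q → ∀ k → p k -ᴿ mean p ≈ᴿ q k -ᴿ mean q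
    π-≋⇒deviations πp≋πq = πp≋πq

    mean-+¹ : ∀ p t n → seq (mean (p +¹ t)) n ≡ seq (mean p) n + seq t n
    mean-+¹ p t n = begin
      c * seq (sumᴿ (p +¹ t)) n                                ≡⟨ cong (c *_) (sumᴿ-+¹ p t n) ⟩
      c * (seq (sumᴿ p) n + (ℤ.+ d / 1) * seq t n)             ≡⟨ expand c (seq (sumᴿ p) n) (ℤ.+ d / 1) (seq t n) ⟩
      c * seq (sumᴿ p) n + (c * (ℤ.+ d / 1)) * seq t n         ≡⟨ cong (λ z → c * seq (sumᴿ p) n + z * seq t n) (1/d*d d) ⟩
      c * seq (sumᴿ p) n + 1ℚ * seq t n                        ≡⟨ cong (c * seq (sumᴿ p) n +_) (ℚ.*-identityˡ (seq t n)) ⟩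
      c * seq (sumᴿ p) n + seq t n                             ∎
      where
      open ≡-Reasoning
      c = ℤ.+ 1 / d
      expand : ∀ c s e t → c * (s + e * t) ≡ c * s + (c * e) * t
      expand = solve-∀ ℚ-ring

    mean-mono-≤ : ∀ {p q} → (∀ k → p k ≤ᴿ q k) → mean p ≤ᴿ mean q
    mean-mono-≤ {p} {q} p≤q = *ᴿ-mono-≤ {sumᴿ p} {sumᴿ q} (ℤ.+ 1 / d) {{ℚ.normalize-pos 1 d}} (sumᴿ-mono-≤ {p = p} {q} p≤q)

    π-+¹ : ∀ p t k n → seq (π (p +¹ t) k) n ≡ seq (π p k) n
    π-+¹ p t k n = trans (cong (λ m → seq (p k) n + seq t n + - m) (mean-+¹ p t n))
      (drop (seq (p k) n) (seq t n) (seq (mean p) n))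
      where
      drop : ∀ a t m → a + t + - (m + t) ≡ a + - m
      drop = solve-∀ ℚ-ring

    π∈Δ : ∀ p → Δ d (π p)
    π∈Δ p = ≗⇒≈ {sumᴿ (π p)} {0ᴿ} λ n → begin
      -- `π p` is by definition the translate of `p` by minus its mean.
      seq (sumᴿ (p +¹ (-ᴿ mean p))) n                     ≡⟨ sumᴿ-+¹ p (-ᴿ mean p) n ⟩
      s n + D * (- (c * s n))                             ≡⟨ factor (s n) c D ⟩
      (1ℚ - c * D) * s n                                  ≡⟨ cong (λ z → (1ℚ - z) * s n) (1/d*d d) ⟩
      0ℚ * s n                                            ≡⟨ ℚ.*-zeroˡ (s n) ⟩
      0ℚ                                                  ∎
      where
      open ≡-Reasoning
      c = ℤ.+ 1 / d
      D = ℤ.+ d / 1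
      s = seq (sumᴿ p)
      factor : ∀ s c e → s + e * (- (c * s)) ≡ (1ℚ - c * e) * s
      factor = solve-∀ ℚ-ring

    π-Δ : ∀ {q} → Δ d q → π q ≋ q
    π-Δ {q} (s≤0 , 0≤s) k =
      ≤-by {0ᴿ} {mean q} {q k} {π q k}
        (≤ᴿ-trans {0ᴿ} {c *ᴿ 0ᴿ} {mean q} (≗⇒≤ {0ᴿ} {c *ᴿ 0ᴿ} λ _ → sym (ℚ.*-zeroʳ c)) (*ᴿ-mono-≤ {0ᴿ} {sumᴿ q} c {{c-pos}} 0≤s))
        (λ n → below (seq (q k) n) (seq (mean q) n)) ,
      ≤-by {mean q} {0ᴿ} {π q k} {q k}
        (≤ᴿ-trans {mean q} {c *ᴿ 0ᴿ} {0ᴿ} (*ᴿ-mono-≤ {sumᴿ q} {0ᴿ} c {{c-pos}} s≤0) (≗⇒≤ {c *ᴿ 0ᴿ} {0ᴿ} λ _ → ℚ.*-zeroʳ c))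
        (λ n → above (seq (q k) n) (seq (mean q) n))
      where
      c = ℤ.+ 1 / d
      c-pos : ℚ.Positive c
      c-pos = ℚ.normalize-pos 1 d
      below : ∀ a m → a - (a + - m) ≡ m - 0ℚ
      below = solve-∀ ℚ-ring
      above : ∀ a m → (a + - m) - a ≡ 0ℚ - m
      above = solve-∀ ℚ-ring

-- Facets as systems of coordinate inequalities.

module Facets where
  open import Data.Integer.Base using (_+_; _-_)
  open Determinant
  open DualMap
  open RealOrder

  ≤ℤ-by : ∀ {a b u v} → a ℤ.≤ b → v - u ≡ b - a → u ℤ.≤ v
  ≤ℤ-by a≤b eq = ℤ.0≤i-j⇒j≤i (subst (0ℤ ℤ.≤_) (sym eq) (ℤ.i≤j⇒0≤j-i a≤b))

  0≤1 : 0ℤ ℤ.≤ 1ℤ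
  0≤1 = ℤ.+≤+ ℕ.z≤n

  -- Both doubled sides are even, so a slack of 1 is harmless. This is how doubled coordinates,
  -- introduced to keep facet centres integral, are halved again.
  half-≤ : ∀ {a b} → a + a ℤ.≤ b + b + 1ℤ → a ℤ.≤ b
  half-≤ {a} {b} p with a ℤ.≤? b
  ... | yes a≤b = a≤b
  ... | no  a≰b = contradiction 1≤0 λ { (ℤ.+≤+ ()) }
    where
    b<a : 1ℤ + b ℤ.≤ a
    b<a = ℤ.i<j⇒suc[i]≤j (ℤ.≰⇒> a≰b)
    arith : ∀ a b → 0ℤ - 1ℤ ≡ (a + a + (b + b + 1ℤ)) - ((1ℤ + b) + (1ℤ + b) + (a + a))
    arith = solveℤ
    1≤0 : 1ℤ ℤ.≤ 0ℤ
    1≤0 = ≤ℤ-by (ℤ.+-mono-≤ (ℤ.+-mono-≤ b<a b<a) p) (arith a b)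

  e-bounds : ∀ {d} (i k : Fin d) → 0ℤ ℤ.≤ lookup (e i) k × lookup (e i) k ℤ.≤ 1ℤ
  e-bounds i k with k Fin.≟ i
  ... | yes refl = subst (λ z → 0ℤ ℤ.≤ z × z ℤ.≤ 1ℤ) (sym (lookup-e-≡ k)) (ℤ.+≤+ ℕ.z≤n , ℤ.≤-refl)
  ... | no  k≢i  = subst (λ z → 0ℤ ℤ.≤ z × z ℤ.≤ 1ℤ) (sym (lookup-e-≢ k≢i)) (ℤ.≤-refl , ℤ.+≤+ ℕ.z≤n)

  lookup-+ᵛ-e-≡ : ∀ {d} (x : Vec ℤ d) i → lookup (x +ᵛ e i) i ≡ lookup x i + 1ℤ
  lookup-+ᵛ-e-≡ x i = trans (lookup-+ᵛ x (e i) i) (cong (lookup x i +_) (lookup-e-≡ i))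

  lookup-+ᵛ-e-≢ : ∀ {d} (x : Vec ℤ d) {i k} → k ≢ i → lookup (x +ᵛ e i) k ≡ lookup x k
  lookup-+ᵛ-e-≢ x {i} {k} k≢i = trans (lookup-+ᵛ x (e i) k)
    (trans (cong (lookup x k +_) (lookup-e-≢ k≢i)) (ℤ.+-identityʳ (lookup x k)))

  -- Off `i` the parameter λₖ is pₖ - xₖ; eliminating it leaves only comparisons of coordinates with
  -- integers. The converse below restores it by the same formula.
  facet⇒bounds : ∀ {d} (x : Vec ℤ d) i p → Facet x i p →
    p i ≈ᴿ fromℤ (lookup x i + 1ℤ) ×
    (∀ k → k ≢ i → fromℤ (lookup x k) ≤ᴿ p k × p k ≤ᴿ fromℤ (lookup x k + 1ℤ))
  facet⇒bounds {d} x i p (λ′ , 0≤λ≤1 , p≋) = at-i , off-i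
    where
    at-i : p i ≈ᴿ fromℤ (lookup x i + 1ℤ)
    at-i with i Fin.≟ i | p≋ i
    ... | yes _  | eq = ≈ᴿ-trans {p i} {fromℤ (lookup (x +ᵛ e i) i) +ᴿ 0ᴿ} {fromℤ (lookup x i + 1ℤ)} eq
      (≗⇒≈ {fromℤ (lookup (x +ᵛ e i) i) +ᴿ 0ᴿ} {fromℤ (lookup x i + 1ℤ)} λ _ →
        trans (ℚ.+-identityʳ _) (cong (ℚ._/ 1) (lookup-+ᵛ-e-≡ x i)))
    ... | no i≢i | _  = contradiction refl i≢i
    off-i : ∀ k → k ≢ i → fromℤ (lookup x k) ≤ᴿ p k × p k ≤ᴿ fromℤ (lookup x k + 1ℤ)
    off-i k k≢i with k Fin.≟ i | p≋ k
    ... | yes k≡i | _  = contradiction k≡i k≢i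
    ... | no  _   | p≤ , ≤p with 0≤λ , λ≤1 ← 0≤λ≤1 k k≢i =
        ≤-by {0ᴿ +ᴿ (fromℤ y +ᴿ λ′ k)} {λ′ k +ᴿ p k} {p k} {fromℤ (lookup x k)}
          (+-mono-≤ᴿ {0ᴿ} {λ′ k} {fromℤ y +ᴿ λ′ k} {p k} 0≤λ ≤p)
          (λ n → trans (cong (λ z → seq (p k) n ℚ.- z ℚ./ 1) (sym y≡)) (lower (seq (p k) n) (y ℚ./ 1) (seq (λ′ k) n))) ,
        ≤-by {λ′ k +ᴿ p k} {1ᴿ +ᴿ (fromℤ y +ᴿ λ′ k)} {fromℤ (lookup x k + 1ℤ)} {p k}
          (+-mono-≤ᴿ {λ′ k} {1ᴿ} {p k} {fromℤ y +ᴿ λ′ k} λ≤1 p≤)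
          (λ n → trans (cong (ℚ._- seq (p k) n) (trans (cong (λ z → (z + 1ℤ) ℚ./ 1) (sym y≡)) (/1-homo-+ y 1ℤ)))
                       (upper (seq (p k) n) (y ℚ./ 1) (seq (λ′ k) n)))
      where
      y = lookup (x +ᵛ e i) k
      y≡ : y ≡ lookup x k
      y≡ = lookup-+ᵛ-e-≢ x k≢i
      lower : ∀ p y l → p ℚ.- y ≡ (l ℚ.+ p) ℚ.- (0ℚ ℚ.+ (y ℚ.+ l))
      lower = solve-∀ ℚ-ring
      upper : ∀ p y l → (y ℚ.+ 1ℚ) ℚ.- p ≡ (1ℚ ℚ.+ (y ℚ.+ l)) ℚ.- (l ℚ.+ p)
      upper = solve-∀ ℚ-ring

  bounds⇒facet : ∀ {d} (x : Vec ℤ d) i p →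
    p i ≈ᴿ fromℤ (lookup x i + 1ℤ) →
    (∀ k → k ≢ i → fromℤ (lookup x k) ≤ᴿ p k × p k ≤ᴿ fromℤ (lookup x k + 1ℤ)) → Facet x i p
  bounds⇒facet x i p at-i off-i = λ′ , bounds , eq
    where
    λ′ : ∀ k → ℝ
    λ′ k = p k -ᴿ fromℤ (lookup x k)
    bounds : ∀ k → k ≢ i → 0ᴿ ≤ᴿ λ′ k × λ′ k ≤ᴿ 1ᴿ
    bounds k k≢i with lo , hi ← off-i k k≢i =
      ≤-by {fromℤ (lookup x k)} {p k} {λ′ k} {0ᴿ} lo (λ n → lower (seq (p k) n) (lookup x k ℚ./ 1)) ,
      ≤-by {p k} {fromℤ (lookup x k + 1ℤ)} {1ᴿ} {λ′ k} hi
        (λ n → trans (upper (seq (p k) n) (lookup x k ℚ./ 1)) (cong (ℚ._- seq (p k) n) (sym (/1-homo-+ (lookup x k) 1ℤ))))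
      where
      lower : ∀ p y → (p ℚ.+ ℚ.- y) ℚ.- 0ℚ ≡ p ℚ.- y
      lower = solve-∀ ℚ-ring
      upper : ∀ p y → 1ℚ ℚ.- (p ℚ.+ ℚ.- y) ≡ (y ℚ.+ 1ℚ) ℚ.- p
      upper = solve-∀ ℚ-ring
    eq : p ≋ λ k → fromℤ (lookup (x +ᵛ e i) k) +ᴿ (if does (k Fin.≟ i) then 0ᴿ else λ′ k)
    eq k with k Fin.≟ i
    ... | yes refl = ≈ᴿ-trans {p k} {fromℤ (lookup x k + 1ℤ)} {fromℤ (lookup (x +ᵛ e k) k) +ᴿ 0ᴿ} at-i
      (≗⇒≈ {fromℤ (lookup x k + 1ℤ)} {fromℤ (lookup (x +ᵛ e k) k) +ᴿ 0ᴿ} λ _ →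
        sym (trans (ℚ.+-identityʳ _) (cong (ℚ._/ 1) (lookup-+ᵛ-e-≡ x k))))
    ... | no k≢i = ≗⇒≈ {p k} {fromℤ (lookup (x +ᵛ e i) k) +ᴿ λ′ k} λ n →
      trans (cancelled (seq (p k) n) (lookup x k ℚ./ 1))
            (cong (λ z → z ℚ./ 1 ℚ.+ seq (λ′ k) n) (sym (lookup-+ᵛ-e-≢ x k≢i)))
      where
      cancelled : ∀ p y → p ≡ y ℚ.+ (p ℚ.+ ℚ.- y)
      cancelled = solve-∀ ℚ-ring

  -- The jump lies between 0 and 1 because these are the heights of x + eᵢ and x when (x, i) is a
  -- facet of the surface.
  step : ℤ → ℤ
  step (ℤ.+ zero)  = 0ℤ
  step (ℤ.+ suc _) = 1ℤ
  step -[1+ _ ]  = 0ℤ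

  -- m and μ are the means of two points of ℝᵈ with the same projection; S, S′
  -- and w / 2, w′ / 2 are coordinates of these points.
  compare-halves : ∀ {S S′ m μ y z w w′} → fromℤ y ≤ᴿ S → S -ᴿ m ≤ᴿ ½ *ᴿ fromℤ w -ᴿ μ →
    ½ *ᴿ fromℤ w′ -ᴿ μ ≤ᴿ S′ -ᴿ m → S′ ≤ᴿ fromℤ z → y + y + w′ ℤ.≤ w + (z + z)
  compare-halves {S} {S′} {m} {μ} {y} {z} {w} {w′} p q r s = fromℤ-cancel-≤ {y + y + w′} {w + (z + z)}
    -- The sum of the four hypotheses is A ≤ B, in which S, S′, m and μ cancel; doubling it clears
    -- the factor ½.
    (≤-by {A +ᴿ A} {B +ᴿ B} {fromℤ (w + (z + z))} {fromℤ (y + y + w′)} (+-mono-≤ᴿ {A} {B} {A} {B} A≤B A≤B)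
      λ n → trans
        (cong₂ ℚ._-_ (trans (/1-homo-+ w (z + z)) (cong (w ℚ./ 1 ℚ.+_) (/1-homo-+ z z)))
                     (trans (/1-homo-+ (y + y) w′) (cong (ℚ._+ w′ ℚ./ 1) (/1-homo-+ y y))))
        (arith (y ℚ./ 1) (z ℚ./ 1) (w ℚ./ 1) (w′ ℚ./ 1) (seq S n) (seq S′ n) (seq m n) (seq μ n)))
    where
    A B : ℝ
    A = fromℤ y +ᴿ (S -ᴿ m) +ᴿ (½ *ᴿ fromℤ w′ -ᴿ μ +ᴿ S′)
    B = S +ᴿ (½ *ᴿ fromℤ w -ᴿ μ) +ᴿ (S′ -ᴿ m +ᴿ fromℤ z)
    A≤B : A ≤ᴿ B
    A≤B = +-mono-≤ᴿ {fromℤ y +ᴿ (S -ᴿ m)} {S +ᴿ (½ *ᴿ fromℤ w -ᴿ μ)} {½ *ᴿ fromℤ w′ -ᴿ μ +ᴿ S′} {S′ -ᴿ m +ᴿ fromℤ z}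
      (+-mono-≤ᴿ {fromℤ y} {S} {S -ᴿ m} {½ *ᴿ fromℤ w -ᴿ μ} p q)
      (+-mono-≤ᴿ {½ *ᴿ fromℤ w′ -ᴿ μ} {S′ -ᴿ m} {S′} {fromℤ z} r s)
    arith : ∀ y z w w′ S S′ m μ → (w ℚ.+ (z ℚ.+ z)) ℚ.- ((y ℚ.+ y) ℚ.+ w′) ≡
      ((S ℚ.+ (½ ℚ.* w ℚ.+ ℚ.- μ) ℚ.+ (S′ ℚ.+ ℚ.- m ℚ.+ z)) ℚ.+ (S ℚ.+ (½ ℚ.* w ℚ.+ ℚ.- μ) ℚ.+ (S′ ℚ.+ ℚ.- m ℚ.+ z)))
      ℚ.- ((y ℚ.+ (S ℚ.+ ℚ.- m) ℚ.+ (½ ℚ.* w′ ℚ.+ ℚ.- μ ℚ.+ S′)) ℚ.+ (y ℚ.+ (S ℚ.+ ℚ.- m) ℚ.+ (½ ℚ.* w′ ℚ.+ ℚ.- μ ℚ.+ S′)))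
    arith = solve-∀ ℚ-ring

-- The height function of a stepped surface.

module SurfaceHeight where
  open import Data.Integer.Base using (_+_; _-_)
  open Determinant
  open DualMap
  open RealOrder
  open Projection
  open Facets

  module _ {m n} {f : ℝ^ m → ℝ^ n} {A B} (h : RestrictsToHomeomorphism f A B) where
    open RestrictsToHomeomorphism h

    -- A homeomorphism does not come with a proof that its inverse respects `≋`. Continuity supplies
    -- it: `q` is within every δ of `p`, so the images are within every ε.
    inverse-cong : ∀ {p q} → B p → B q → p ≋ q → inverse p ≋ inverse q
    inverse-cong {p} {q} Bp Bq p≋q k = below , above
      where
      close : ∀ ε → 0ℚ ℚ.< ε → Close (fromℚ ε) (inverse p) (inverse q)
      close ε 0<ε = let δ , 0<δ , cont = from-continuous p Bp (fromℚ ε) (positive ε 0<ε) in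
        cont q Bq λ k →
          ≤-<-trans {p k -ᴿ q k} {0ᴿ} {δ} (diff {p k} {q k} (proj₁ (p≋q k))) 0<δ ,
          ≤-<-trans {q k -ᴿ p k} {0ᴿ} {δ} (diff {q k} {p k} (proj₂ (p≋q k))) 0<δ
        where
        positive : ∀ ε → 0ℚ ℚ.< ε → 0ᴿ <ᴿ fromℚ ε
        positive ε 0<ε = ½ ℚ.* ε , ½* 0<ε , 0 , λ _ _ →
          subst (0ℚ ℚ.+ ½ ℚ.* ε ℚ.<_) (½*+½* ε) (ℚ.+-monoˡ-< (½ ℚ.* ε) (½* 0<ε))
        diff : ∀ {x y} → x ≤ᴿ y → x -ᴿ y ≤ᴿ 0ᴿ
        diff {x} {y} x≤y = ≤-by {x} {y} {0ᴿ} {x -ᴿ y} x≤y λ n → arith (seq x n) (seq y n)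
          where
          arith : ∀ a b → 0ℚ ℚ.- (a ℚ.+ ℚ.- b) ≡ b ℚ.- a
          arith = solve-∀ ℚ-ring
      ≤-close : ∀ x y ε → x -ᴿ y <ᴿ fromℚ ε → ∃[ N ] ∀ n → N ℕ.≤ n → seq x n ℚ.< seq y n ℚ.+ ε
      ≤-close x y ε (η , 0<η , N , p) = N , λ n N≤n →
        <-by (ℚ.<-trans (ℚ.+-monoʳ-< (seq x n ℚ.+ ℚ.- seq y n) 0<η) (p n N≤n)) (arith (seq x n) (seq y n) ε)
        where
        arith : ∀ a b e → (b ℚ.+ e) ℚ.- a ≡ e ℚ.- ((a ℚ.+ ℚ.- b) ℚ.+ 0ℚ)
        arith = solve-∀ ℚ-ring
      below : inverse p k ≤ᴿ inverse q k
      below ε 0<ε = ≤-close (inverse p k) (inverse q k) ε (proj₁ (close ε 0<ε k))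
      above : inverse q k ≤ᴿ inverse p k
      above ε 0<ε = ≤-close (inverse q k) (inverse p k) ε (proj₂ (close ε 0<ε k))

  IsVertex : ∀ {d} → SteppedFunction d → (Fin d → ℤ) → Set
  IsVertex E p = ∃[ y ] ∃[ i ] E y i ≡ 1ℤ × p i ≡ lookup y i + 1ℤ ×
                 (∀ k → k ≢ i → lookup y k ℤ.≤ p k × p k ℤ.≤ lookup y k + 1ℤ)

  IsCoboundary : ∀ {d} → SteppedFunction d → (Vec ℤ d → ℤ) → Set
  IsCoboundary E χ = ∀ x i → E x i ≡ χ x - χ (x +ᵛ e i)

  -- The point of the line through w / 2 along (1,...,1) whose i-th coordinate is yᵢ + 1 lies on the
  -- facet (y, i). Its shift yᵢ + 1 - wᵢ / 2 has been substituted and everything doubled, so that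
  -- only integers remain.
  FacetAbove : ∀ {d} → (Fin d → ℤ) → Vec ℤ d → Fin d → Set
  FacetAbove w y i = ∀ k → k ≢ i →
    lookup y k + lookup y k + w i ℤ.≤ w k + (lookup y i + 1ℤ + (lookup y i + 1ℤ)) ×
    w k + (lookup y i + 1ℤ + (lookup y i + 1ℤ)) ℤ.≤ lookup y k + 1ℤ + (lookup y k + 1ℤ) + w i

  -- Twice the centre of the facet (x , i).
  centre : ∀ {d} → Vec ℤ d → Fin d → Fin d → ℤ
  centre x i k = lookup x k + lookup x k + 1ℤ + lookup (e i) k

  halved : ∀ {d} → (Fin d → ℤ) → ℝ^ d
  halved w k = ½ *ᴿ fromℤ (w k)

  module _ {d} .{{nz : NonZero d}} where

    facet-above : ∀ (w : Fin d → ℤ) S (y : Vec ℤ d) i →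
      (S i ≈ᴿ fromℤ (lookup y i + 1ℤ) ×
       (∀ k → k ≢ i → fromℤ (lookup y k) ≤ᴿ S k × S k ≤ᴿ fromℤ (lookup y k + 1ℤ))) →
      (∀ k → S k -ᴿ mean {{nz}} S ≈ᴿ halved w k -ᴿ mean {{nz}} (halved w)) →
      FacetAbove w y i
    facet-above w S y i ((Sᵢ≤ , ≤Sᵢ) , off-i) eq k k≢i =
      compare-halves {S k} {S i} {mean {{nz}} S} {μ} {lookup y k} {lookup y i + 1ℤ} {w k} {w i}
        (proj₁ (off-i k k≢i)) (proj₁ (eq k)) (proj₂ (eq i)) Sᵢ≤ ,
      subst₂ ℤ._≤_ (ℤ.+-comm (z + z) (w k)) (ℤ.+-comm (w i) (z′ + z′))
        (compare-halves {S i} {S k} {mean {{nz}} S} {μ} {z} {z′} {w i} {w k}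
          ≤Sᵢ (proj₁ (eq i)) (proj₂ (eq k)) (proj₂ (off-i k k≢i)))
      where
      z = lookup y i + 1ℤ
      z′ = lookup y k + 1ℤ
      μ = mean {{nz}} (halved w)

  module _ {d} .{{nz : NonZero d}} (E : SteppedFunction d) (surface : IsSteppedSurface E) where
    open RestrictsToHomeomorphism (proj₂ surface)

    -- w stands for the point w / 2; only facet centres, besides lattice
    -- points, will be needed.
    surface-above : ∀ (w : Fin d → ℤ) → ∃[ y ] ∃[ i ] E y i ≡ 1ℤ × FacetAbove w y i
    surface-above w = above (from (π {{nz}} (halved w)) (π∈Δ {{nz}} (halved w)))
      where
      S : ℝ^ d
      S = inverse (π {{nz}} (halved w))
      above : GeometricInterpretation E S → ∃[ y ] ∃[ i ] E y i ≡ 1ℤ × FacetAbove w y i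
      above (y , i , Eyi≡1 , facet) = y , i , Eyi≡1 ,
        facet-above {{nz}} w S y i (facet⇒bounds y i S facet)
          (π-≋⇒deviations {{nz}} {p = S} {halved w} (inverseʳ (π {{nz}} (halved w)) (π∈Δ {{nz}} (halved w))))

    vertex∈ : ∀ {p} → IsVertex E p → GeometricInterpretation E (λ k → fromℤ (p k))
    vertex∈ {p} (y , i , Eyi≡1 , pᵢ , bounds) = y , i , Eyi≡1 , bounds⇒facet y i (λ k → fromℤ (p k))
      (≗⇒≈ {fromℤ (p i)} {fromℤ (lookup y i + 1ℤ)} λ _ → cong (ℚ._/ 1) pᵢ)
      λ k k≢i → fromℤ-mono-≤ (proj₁ (bounds k k≢i)) , fromℤ-mono-≤ (proj₂ (bounds k k≢i))

    -- The two points differ by a multiple of (1,...,1), hence have equal projections, and π is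
    -- injective on the surface.
    vertex-unique : ∀ {p p′} c → IsVertex E p → IsVertex E p′ → (∀ k → p′ k ≡ p k + c) → c ≡ 0ℤ
    vertex-unique {p} {p′} c v@(_ , i , _) v′ shift = ℤ.≤-antisym
        (≤ℤ-by p′≤p (trans (arith (p i) c) (cong (λ z → p i - z) (sym (shift i)))))
        (≤ℤ-by p≤p′ (trans (arith′ (p i) c) (cong (_- p i) (sym (shift i)))))
      where
      arith : ∀ a c → 0ℤ - c ≡ a - (a + c)
      arith = solveℤ
      arith′ : ∀ a c → c - 0ℤ ≡ (a + c) - a
      arith′ = solveℤ
      P P′ : ℝ^ d
      P  k = fromℤ (p k)
      P′ k = fromℤ (p′ k)
      πP′≗πP : ∀ k n → seq (π {{nz}} P′ k) n ≡ seq (π {{nz}} P k) n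
      πP′≗πP k n = trans (cong₂ (λ a s → a ℚ.+ ℚ.- ((ℤ.+ 1 ℚ./ d) ℚ.* s)) (split k) (sum-split (λ k → P′ k) _ split))
        (π-+¹ {{nz}} P (fromℤ c) k n)
        where
        split : ∀ k → seq (P′ k) n ≡ seq (P k) n ℚ.+ c ℚ./ 1
        split k = trans (cong (ℚ._/ 1) (shift k)) (/1-homo-+ (p k) c)
        sum-split : ∀ {d} (a b : ℝ^ d) → (∀ k → seq (a k) n ≡ seq (b k) n) → seq (sumᴿ a) n ≡ seq (sumᴿ b) n
        sum-split {zero}  a b eq = refl
        sum-split {suc d} a b eq = cong₂ ℚ._+_ (eq zero) (sum-split (λ k → a (suc k)) (λ k → b (suc k)) (λ k → eq (suc k)))
      P′≋P : P′ ≋ P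
      P′≋P k = ≈ᴿ-trans {P′ k} {inverse (π {{nz}} P′) k} {P k} (≈ᴿ-sym {inverse (π {{nz}} P′) k} {P′ k} (inverseˡ P′ (vertex∈ v′) k))
        (≈ᴿ-trans {inverse (π {{nz}} P′) k} {inverse (π {{nz}} P) k} {P k}
          (inverse-cong (proj₂ surface) (π∈Δ {{nz}} P′) (π∈Δ {{nz}} P) (λ k → ≗⇒≈ {π {{nz}} P′ k} {π {{nz}} P k} (πP′≗πP k)) k)
          (inverseˡ P (vertex∈ v) k))
      p′≤p : p′ i ℤ.≤ p i
      p′≤p = fromℤ-cancel-≤ (proj₁ (P′≋P i))
      p≤p′ : p i ℤ.≤ p′ i
      p≤p′ = fromℤ-cancel-≤ (proj₂ (P′≋P i))

    abstract
      -- The facet (y, i) met above x has i-th coordinate yᵢ + 1, so the shift is the integer yᵢ + 1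
      -- - xᵢ. As the doubled point is 2x, all bounds have slack and `half-≤` applies.
      vertex-above : ∀ (x : Vec ℤ d) → ∃[ h ] IsVertex E (λ k → lookup x k + h)
      vertex-above x = let y , i , Eyi≡1 , bounds = surface-above (λ k → lookup x k + lookup x k) in
        lookup y i + 1ℤ - lookup x i , y , i , Eyi≡1 , at-i (lookup x i) (lookup y i + 1ℤ) ,
        λ k k≢i →
          half-≤ (≤ℤ-by (ℤ.+-mono-≤ 0≤1 (proj₁ (bounds k k≢i)))
            (lower (lookup y k) (lookup x k) (lookup x i) (lookup y i + 1ℤ))) ,
          half-≤ (≤ℤ-by (ℤ.+-mono-≤ 0≤1 (proj₂ (bounds k k≢i)))
            (upper (lookup y k + 1ℤ) (lookup x k) (lookup x i) (lookup y i + 1ℤ)))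
        where
        at-i : ∀ x z → x + (z - x) ≡ z
        at-i = solveℤ
        lower : ∀ y x xᵢ z → (x + (z - xᵢ)) + (x + (z - xᵢ)) + 1ℤ - (y + y) ≡ (1ℤ + ((x + x) + (z + z))) - (0ℤ + ((y + y) + (xᵢ + xᵢ)))
        lower = solveℤ
        upper : ∀ y x xᵢ z → (y + y + 1ℤ) - ((x + (z - xᵢ)) + (x + (z - xᵢ))) ≡ (1ℤ + ((y + y) + (xᵢ + xᵢ))) - (0ℤ + ((x + x) + (z + z)))
        upper = solveℤ

    height : Vec ℤ d → ℤ
    height x = proj₁ (vertex-above x)

    height-unique : ∀ x h → IsVertex E (λ k → lookup x k + h) → height x ≡ h
    height-unique x h v = trans (regroup (height x) h) (trans (cong (h +_)
      (vertex-unique (height x - h) v (proj₂ (vertex-above x)) λ k → shift (lookup x k) h (height x)))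
      (ℤ.+-identityʳ h))
      where
      regroup : ∀ a h → a ≡ h + (a - h)
      regroup = solveℤ
      shift : ∀ x h a → x + a ≡ x + h + (a - h)
      shift = solveℤ

    -- The facet (y, i) has the opposite corners y + (1,...,1) and y + eᵢ, which lie above x at t +
    -- 1 and above x + eᵢ at t.
    height-below-facet : ∀ {x y i} t → E y i ≡ 1ℤ → (∀ k → lookup y k ≡ lookup x k + t) →
                         height x ≡ t + 1ℤ × height (x +ᵛ e i) ≡ t
    height-below-facet {x} {y} {i} t Eyi≡1 y≡x+t =
      height-unique x (t + 1ℤ) (y , i , Eyi≡1 , top i , λ k _ →
        ≤ℤ-by 0≤1 (trans (cong (_- lookup y k) (top k)) (drop (lookup y k))) , ℤ.≤-reflexive (top k)) ,
      height-unique (x +ᵛ e i) t (y , i , Eyi≡1 ,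
        trans (cong (_+ t) (lookup-+ᵛ-e-≡ x i)) (trans (swap (lookup x i) t) (top i)) ,
        λ k k≢i → let eq = trans (cong (_+ t) (lookup-+ᵛ-e-≢ x k≢i)) (sym (y≡x+t k)) in
          ℤ.≤-reflexive (sym eq) , ≤ℤ-by 0≤1 (trans (cong (λ z → lookup y k + 1ℤ - z) eq) (drop (lookup y k))))
      where
      drop : ∀ y → y + 1ℤ - y ≡ 1ℤ - 0ℤ
      drop = solveℤ
      swap : ∀ x t → x + 1ℤ + t ≡ x + (t + 1ℤ)
      swap = solveℤ
      top : ∀ k → lookup x k + (t + 1ℤ) ≡ lookup y k + 1ℤ
      top k = trans (sym (ℤ.+-assoc (lookup x k) t 1ℤ)) (cong (_+ 1ℤ) (sym (y≡x+t k)))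

    -- The i-th coordinates force an integral shift, so every other coordinate of the shifted centre
    -- is a half-integer and lies in only one unit interval with integral ends.
    centre-on-parallel-facet : ∀ (x : Vec ℤ d) i y → FacetAbove (centre x i) y i →
                               ∀ k → lookup y k ≡ lookup x k + (lookup y i - lookup x i)
    centre-on-parallel-facet x i y bounds = aligned
      where
      at-i : ∀ y x → y ≡ x + (y - x)
      at-i = solveℤ
      lower : ∀ y x yᵢ xᵢ → (x + (yᵢ - xᵢ)) + (x + (yᵢ - xᵢ)) + 1ℤ - (y + y) ≡
        (x + x + 1ℤ + 0ℤ + (yᵢ + 1ℤ + (yᵢ + 1ℤ))) - (y + y + (xᵢ + xᵢ + 1ℤ + 1ℤ))
      lower = solveℤ
      upper : ∀ y x yᵢ xᵢ → y + y + 1ℤ - ((x + (yᵢ - xᵢ)) + (x + (yᵢ - xᵢ))) ≡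
        (y + 1ℤ + (y + 1ℤ) + (xᵢ + xᵢ + 1ℤ + 1ℤ)) - (x + x + 1ℤ + 0ℤ + (yᵢ + 1ℤ + (yᵢ + 1ℤ)))
      upper = solveℤ
      aligned : ∀ k → lookup y k ≡ lookup x k + (lookup y i - lookup x i)
      aligned k with k Fin.≟ i
      ... | yes refl = at-i (lookup y k) (lookup x k)
      ... | no  k≢i  = let lo , hi = bounds k k≢i in ℤ.≤-antisym
        (half-≤ (≤ℤ-by lo (trans (lower (lookup y k) (lookup x k) (lookup y i) (lookup x i))
          (sym (cong₂ (λ a b → (lookup x k + lookup x k + 1ℤ + a + (lookup y i + 1ℤ + (lookup y i + 1ℤ)))
                           - (lookup y k + lookup y k + (lookup x i + lookup x i + 1ℤ + b)))
                 (lookup-e-≢ k≢i) (lookup-e-≡ i))))))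
        (half-≤ (≤ℤ-by hi (trans (upper (lookup y k) (lookup x k) (lookup y i) (lookup x i))
          (sym (cong₂ (λ a b → (lookup y k + 1ℤ + (lookup y k + 1ℤ) + (lookup x i + lookup x i + 1ℤ + b))
                           - (lookup x k + lookup x k + 1ℤ + a + (lookup y i + 1ℤ + (lookup y i + 1ℤ))))
                 (lookup-e-≢ k≢i) (lookup-e-≡ i))))))
    -- Matching the j-th coordinates shifts the centre by m - 1/2, onto the midpoint of the edge
    -- from x + m(1,...,1) in direction i. The facet has integral bounds in that direction and
    -- contains the midpoint, hence both ends, which give x and x + eᵢ the same height.
    centre-on-other-facet : ∀ (x : Vec ℤ d) i y j → j ≢ i → E y j ≡ 1ℤ → FacetAbove (centre x i) y j →
                            height x ≡ height (x +ᵛ e i)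
    centre-on-other-facet x i y j j≢i Eyj≡1 bounds =
      trans (height-unique x m v) (sym (height-unique (x +ᵛ e i) m v′))
      where
      m : ℤ
      m = lookup y j + 1ℤ - lookup x j
      δ : Fin d → ℤ
      δ = lookup (e i)
      at-j : ∀ z x → x + (z - x) ≡ z
      at-j = solveℤ
      low : ∀ y x d xⱼ z → (x + (z - xⱼ)) + (x + (z - xⱼ)) + 1ℤ - (y + y) ≡
        (1ℤ + (x + x + 1ℤ + d + (z + z))) - (d + (y + y + (xⱼ + xⱼ + 1ℤ + 0ℤ)))
      low = solveℤ
      high : ∀ y x d xⱼ z → y + 1ℤ + (y + 1ℤ) + 1ℤ - ((x + d + (z - xⱼ)) + (x + d + (z - xⱼ))) ≡
        (1ℤ + (y + 1ℤ + (y + 1ℤ) + (xⱼ + xⱼ + 1ℤ + 0ℤ))) - (d + (x + x + 1ℤ + d + (z + z)))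
      high = solveℤ
      -- The point x + m has its j-th coordinate in place, and the facet
      -- (y , j) contains the edge in direction i starting there.
      lo : ∀ k → k ≢ j → lookup y k ℤ.≤ lookup x k + m
      lo k k≢j = half-≤ (≤ℤ-by (ℤ.+-mono-≤ (proj₂ (e-bounds i k)) (proj₁ (bounds k k≢j)))
        (trans (low (lookup y k) (lookup x k) (δ k) (lookup x j) (lookup y j + 1ℤ))
          (cong (λ a → (1ℤ + (lookup x k + lookup x k + 1ℤ + δ k + (lookup y j + 1ℤ + (lookup y j + 1ℤ))))
                     - (δ k + (lookup y k + lookup y k + (lookup x j + lookup x j + 1ℤ + a)))) (sym (lookup-e-≢ j≢i)))))
      hi : ∀ k → k ≢ j → lookup x k + δ k + m ℤ.≤ lookup y k + 1ℤ
      hi k k≢j = half-≤ (≤ℤ-by (ℤ.+-mono-≤ (proj₂ (e-bounds i k)) (proj₂ (bounds k k≢j)))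
        (trans (high (lookup y k) (lookup x k) (δ k) (lookup x j) (lookup y j + 1ℤ))
          (cong (λ a → (1ℤ + (lookup y k + 1ℤ + (lookup y k + 1ℤ) + (lookup x j + lookup x j + 1ℤ + a)))
                     - (δ k + (lookup x k + lookup x k + 1ℤ + δ k + (lookup y j + 1ℤ + (lookup y j + 1ℤ))))) (sym (lookup-e-≢ j≢i)))))
      raise : ∀ k → lookup x k + m ℤ.≤ lookup x k + δ k + m
      raise k = ≤ℤ-by (proj₁ (e-bounds i k)) (arith (lookup x k) (δ k) m)
        where
        arith : ∀ x d m → x + d + m - (x + m) ≡ d - 0ℤ
        arith = solveℤ
      v : IsVertex E (λ k → lookup x k + m)
      v = y , j , Eyj≡1 , at-j (lookup y j + 1ℤ) (lookup x j) ,
          λ k k≢j → lo k k≢j , ℤ.≤-trans (raise k) (hi k k≢j)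
      v′ : IsVertex E (λ k → lookup (x +ᵛ e i) k + m)
      v′ = y , j , Eyj≡1 ,
           trans (cong (_+ m) (lookup-+ᵛ-e-≢ x j≢i)) (at-j (lookup y j + 1ℤ) (lookup x j)) ,
           λ k k≢j → subst (λ z → lookup y k ℤ.≤ z + m × z + m ℤ.≤ lookup y k + 1ℤ) (sym (lookup-+ᵛ x (e i) k))
             (ℤ.≤-trans (lo k k≢j) (raise k) , hi k k≢j)

    facet-dichotomy : ∀ x i →
      (∃[ y ] ∃[ t ] E y i ≡ 1ℤ × (∀ k → lookup y k ≡ lookup x k + t)) ⊎ height x ≡ height (x +ᵛ e i)
    facet-dichotomy x i = dichotomy (surface-above (centre x i))
      where
      dichotomy : (∃[ y ] ∃[ j ] E y j ≡ 1ℤ × FacetAbove (centre x i) y j) →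
        (∃[ y ] ∃[ t ] E y i ≡ 1ℤ × (∀ k → lookup y k ≡ lookup x k + t)) ⊎ height x ≡ height (x +ᵛ e i)
      dichotomy (y , j , Eyj≡1 , bounds) = split (j Fin.≟ i)
        where
        split : Dec (j ≡ i) → _
        split (yes refl) = inj₁ (y , lookup y i - lookup x i , Eyj≡1 , centre-on-parallel-facet x i y bounds)
        split (no  j≢i)  = inj₂ (centre-on-other-facet x i y j j≢i Eyj≡1 bounds)

    indicator : Vec ℤ d → ℤ
    indicator x = step (height x)

    facet-coboundary : ∀ {x y i} t → E y i ≡ 1ℤ → (∀ k → lookup y k ≡ lookup x k + t) →
                       indicator x - indicator (x +ᵛ e i) ≡ step (t + 1ℤ) - step t
    facet-coboundary {x} {y} {i} t Eyi≡1 y≡x+t = cong₂ (λ a b → step a - step b)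
      (proj₁ (height-below-facet {x} {y} {i} t Eyi≡1 y≡x+t)) (proj₂ (height-below-facet {x} {y} {i} t Eyi≡1 y≡x+t))

    surface-coboundary : IsCoboundary E indicator
    surface-coboundary x i = [ missing , present ]′ (proj₁ surface x i)
      where
      present : E x i ≡ 1ℤ → E x i ≡ indicator x - indicator (x +ᵛ e i)
      present Exi≡1 = trans Exi≡1 (sym (facet-coboundary {x} {x} {i} 0ℤ Exi≡1 (λ k → sym (ℤ.+-identityʳ (lookup x k)))))
      no-jump : E x i ≡ 0ℤ → ∀ y t → E y i ≡ 1ℤ → (∀ k → lookup y k ≡ lookup x k + t) → step (t + 1ℤ) - step t ≡ 0ℤ
      no-jump _ _ (ℤ.+ suc t)  _ _ = refl
      no-jump _ _ -[1+ zero ]  _ _ = refl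
      no-jump _ _ -[1+ suc t ] _ _ = refl
      -- `step` jumps from t to t + 1 only for t = 0; but then y is x, and the value of `E` there is
      -- 0.
      no-jump Exi≡0 y (ℤ.+ zero) Eyi≡1 y≡x =
        contradiction (trans (sym Exi≡0) (trans (cong (λ z → E z i) (sym y≡)) Eyi≡1)) λ ()
        where
        y≡ : y ≡ x
        y≡ = vec-ext λ k → trans (y≡x k) (ℤ.+-identityʳ (lookup x k))
      missing : E x i ≡ 0ℤ → E x i ≡ indicator x - indicator (x +ᵛ e i)
      missing Exi≡0 = trans Exi≡0 (sym ([
          (λ (y , t , Eyi≡1 , y≡x+t) → trans (facet-coboundary {x} {y} {i} t Eyi≡1 y≡x+t) (no-jump Exi≡0 y t Eyi≡1 y≡x+t))
        , (λ eq → trans (cong (λ h → indicator x - step h) (sym eq)) (ℤ.+-inverseʳ (indicator x)))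
        ]′ (facet-dichotomy x i)))

    -- Translating the base point by c(1,...,1) lowers its height by c, so a translate of the origin
    -- suffices.
    height-surjective : ∀ h → ∃[ x ] height x ≡ h
    height-surjective h = x , height-unique x h (proj₁ v , proj₁ (proj₂ v) , proj₁ (proj₂ (proj₂ v)) ,
        trans (at (proj₁ (proj₂ v))) (proj₁ (proj₂ (proj₂ (proj₂ v)))) ,
        λ k k≢i → subst (λ z → lookup (proj₁ v) k ℤ.≤ z × z ℤ.≤ lookup (proj₁ v) k + 1ℤ) (sym (at k)) (proj₂ (proj₂ (proj₂ (proj₂ v))) k k≢i))
      where
      v = proj₂ (vertex-above 0ᵛ)
      x : Vec ℤ d
      x = tabulate λ k → lookup 0ᵛ k + (height 0ᵛ - h)
      arith : ∀ a g h → a + (g - h) + h ≡ a + g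
      arith = solveℤ
      at : ∀ k → lookup x k + h ≡ lookup 0ᵛ k + height 0ᵛ
      at k = trans (cong (_+ h) (Vec.lookup∘tabulate (λ k → lookup 0ᵛ k + (height 0ᵛ - h)) k)) (arith (lookup 0ᵛ k) (height 0ᵛ) h)

-- Discrete intermediate values, floors and extrema.

module Lattice where
  open import Data.Integer.Base using (_+_; _-_)
  open DualMap
  open RealOrder
  open Facets

  infix 4 _≤ᵛ_

  _≤ᵛ_ : ∀ {d} → Vec ℤ d → Vec ℤ d → Set
  x ≤ᵛ y = ∀ k → lookup x k ℤ.≤ lookup y k

  i≤i+1 : ∀ i → i ℤ.≤ i + 1ℤ
  i≤i+1 i = ≤ℤ-by 0≤1 (arith i)
    where
    arith : ∀ i → i + 1ℤ - i ≡ 1ℤ - 0ℤ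
    arith = solveℤ

  ≰⇒+1≤ : ∀ {i j} → ¬ i ℤ.≤ j → j + 1ℤ ℤ.≤ i
  ≰⇒+1≤ {i} {j} i≰j = subst (ℤ._≤ i) (ℤ.+-comm 1ℤ j) (ℤ.i<j⇒suc[i]≤j (ℤ.≰⇒> i≰j))

  module _ (Q : ℤ → Set) (Q? : ∀ m → Dec (Q m)) where

    last-true-from : ∀ k m → Q m → ¬ Q (m + ℤ.+ k) →
                     ∃[ l ] m ℤ.≤ l × l + 1ℤ ℤ.≤ m + ℤ.+ k × Q l × ¬ Q (l + 1ℤ)
    last-true-from zero    m Qm ¬Qn = contradiction (subst Q (sym (ℤ.+-identityʳ m)) Qm) ¬Qn
    last-true-from (suc k) m Qm ¬Qn = decide (Q? (m + 1ℤ))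
      where
      n≡ : m + 1ℤ + ℤ.+ k ≡ m + ℤ.+ suc k
      n≡ = ℤ.+-assoc m 1ℤ (ℤ.+ k)
      decide : Dec (Q (m + 1ℤ)) → _
      decide (no ¬Q) = m , ℤ.≤-refl , ℤ.+-monoʳ-≤ m (ℤ.+≤+ (ℕ.s≤s ℕ.z≤n)) , Qm , ¬Q
      decide (yes q) with l , m+1≤l , l<n , Ql , ¬Ql ← last-true-from k (m + 1ℤ) q (subst (λ n → ¬ Q n) (sym n≡) ¬Qn) =
        l , ℤ.≤-trans (i≤i+1 m) m+1≤l , subst (l + 1ℤ ℤ.≤_) n≡ l<n , Ql , ¬Ql

    last-true : ∀ {m n} → m ℤ.≤ n → Q m → ¬ Q n →
                ∃[ l ] m ℤ.≤ l × l + 1ℤ ℤ.≤ n × Q l × ¬ Q (l + 1ℤ)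
    last-true {m} {n} m≤n Qm ¬Qn =
      let l , m≤l , l<n , Ql , ¬Ql = last-true-from ℤ.∣ n - m ∣ m Qm (subst (λ n → ¬ Q n) (sym n≡) ¬Qn)
      in l , m≤l , subst (l + 1ℤ ℤ.≤_) n≡ l<n , Ql , ¬Ql
      where
      arith : ∀ m n → m + (n - m) ≡ n
      arith = solveℤ
      n≡ : m + ℤ.+ ℤ.∣ n - m ∣ ≡ n
      n≡ = trans (cong (m +_) (ℤ.0≤i⇒+∣i∣≡i (ℤ.i≤j⇒0≤j-i m≤n))) (arith m n)

  -- A monotone lattice path leads from u to v, raising the tail coordinates before the head; P must
  -- fail along one of its edges. That this edge stays in the box between u and v is what later
  -- locates a facet.
  crossing : ∀ {d} (P : Vec ℤ d → Set) (P? : ∀ x → Dec (P x)) u v → u ≤ᵛ v → P u → ¬ P v →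
             ∃[ y ] ∃[ i ] u ≤ᵛ y × y +ᵛ e i ≤ᵛ v × P y × ¬ P (y +ᵛ e i)
  crossing P P? []       []       _   Pu ¬Pv = contradiction Pu ¬Pv
  crossing P P? (a ∷ us) (b ∷ vs) u≤v Pu ¬Pv with P? (a ∷ vs)
  ... | yes p with l , a≤l , l<b , Pl , ¬Pl ← last-true (λ m → P (m ∷ vs)) (λ m → P? (m ∷ vs)) (u≤v zero) p ¬Pv =
    l ∷ vs , zero , (λ { zero → a≤l ; (suc k) → u≤v (suc k) }) ,
    (λ { zero → l<b ; (suc k) → ℤ.≤-reflexive (cong (λ x → lookup x k) (+ᵛ-identityʳ vs)) }) ,
    Pl , subst (λ x → ¬ P (l + 1ℤ ∷ x)) (sym (+ᵛ-identityʳ vs)) ¬Pl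
  ... | no ¬p with y , i , us≤y , y<vs , Py , ¬Py ← crossing (λ x → P (a ∷ x)) (λ x → P? (a ∷ x)) us vs (λ k → u≤v (suc k)) Pu ¬p =
    a ∷ y , suc i , (λ { zero → ℤ.≤-refl ; (suc k) → us≤y k }) ,
    (λ { zero → subst (ℤ._≤ b) (sym (ℤ.+-identityʳ a)) (u≤v zero) ; (suc k) → y<vs k }) ,
    Py , subst (λ h → ¬ P (h ∷ y +ᵛ e i)) (sym (ℤ.+-identityʳ a)) ¬Py

  lower-bound : ∀ {n} (f : Fin n → ℤ) → ∃[ L ] ∀ k → L ℤ.≤ f k
  lower-bound {zero}  f = 0ℤ , λ ()
  lower-bound {suc n} f with L , L≤ ← lower-bound (λ k → f (suc k)) =
    f zero ℤ.⊓ L , λ { zero → ℤ.i⊓j≤i (f zero) L ; (suc k) → ℤ.≤-trans (ℤ.i⊓j≤j (f zero) L) (L≤ k) }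

  upper-bound : ∀ {n} (f : Fin n → ℤ) → ∃[ U ] ∀ k → f k ℤ.≤ U
  upper-bound {zero}  f = 0ℤ , λ ()
  upper-bound {suc n} f with U , ≤U ← upper-bound (λ k → f (suc k)) =
    f zero ℤ.⊔ U , λ { zero → ℤ.i≤i⊔j (f zero) U ; (suc k) → ℤ.≤-trans (≤U k) (ℤ.i≤j⊔i (f zero) U) }

  module _ (em : ExcludedMiddle 0ℓ) where

    abstract
      floor : ∀ r → ∃[ b ] fromℤ b ≤ᴿ r × ¬ fromℤ (b + 1ℤ) ≤ᴿ r
      floor r = let K , r≤K = archimedean r
                    L , L≤r = archimedean′ r
                    K+1≰r : ¬ fromℤ (K + 1ℤ) ≤ᴿ r
                    K+1≰r K+1≤r = K+1≰K K (fromℤ-cancel-≤ {K + 1ℤ} {K} (≤ᴿ-trans {fromℤ (K + 1ℤ)} {r} {fromℤ K} K+1≤r r≤K))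
                    L≤K+1 = ℤ.≤-trans (fromℤ-cancel-≤ {L} {K} (≤ᴿ-trans {fromℤ L} {r} {fromℤ K} L≤r r≤K)) (i≤i+1 K)
                    b , _ , _ , b≤r , b+1≰r = last-true (λ m → fromℤ m ≤ᴿ r) (λ _ → em) L≤K+1 L≤r K+1≰r
                in b , b≤r , b+1≰r
        where
        K+1≰K : ∀ K → ¬ K + 1ℤ ℤ.≤ K
        K+1≰K K p = contradiction (≤ℤ-by {K + 1ℤ} {K} {1ℤ} {0ℤ} p (arith K)) λ { (ℤ.+≤+ ()) }
          where
          arith : ∀ K → 0ℤ - 1ℤ ≡ K - (K + 1ℤ)
          arith = solveℤ

    module _ (_⊑_ : ℝ → ℝ → Set) (⊑-trans : ∀ {x y z} → x ⊑ y → y ⊑ z → x ⊑ z)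
             (⊑-total : ∀ x y → x ⊑ y ⊎ y ⊑ x) where

      -- The order is a parameter so that reversing `≤ᴿ` also yields greatest elements.
      least : ∀ {n} (f : Fin n → ℝ) (P : Fin n → Set) → (∃[ k ] P k) →
              ∃[ k ] P k × (∀ j → P j → f k ⊑ f j)
      least {suc n} f P nonempty = cases nonempty em em
        where
        ⊑-refl : ∀ x → x ⊑ x
        ⊑-refl x = [ (λ p → p) , (λ p → p) ]′ (⊑-total x x)
        cases : (∃[ k ] P k) → Dec (∃[ k ] P (suc k)) → Dec (P zero) → ∃[ k ] P k × (∀ j → P j → f k ⊑ f j)
        cases (zero  , p) (no ¬S) (no ¬Z) = contradiction p ¬Z
        cases (suc k , p) (no ¬S) (no ¬Z) = contradiction (k , p) ¬S
        cases _ (no ¬S) (yes Z) = zero , Z , λ { zero _ → ⊑-refl (f zero) ; (suc j) Pj → contradiction (j , Pj) ¬S }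
        cases _ (yes S) Z? with k , Pk , k-least ← least (λ k → f (suc k)) (λ k → P (suc k)) S | Z?
        ... | no ¬Z = suc k , Pk , λ { zero Z → contradiction Z ¬Z ; (suc j) → k-least j }
        ... | yes Z with ⊑-total (f zero) (f (suc k))
        ...   | inj₁ 0⊑k = zero , Z , λ { zero _ → ⊑-refl (f zero) ; (suc j) Pj → ⊑-trans 0⊑k (k-least j Pj) }
        ...   | inj₂ k⊑0 = suc k , Pk , λ { zero _ → k⊑0 ; (suc j) → k-least j }

    ≤ᴿ-total : ∀ x y → x ≤ᴿ y ⊎ y ≤ᴿ x
    ≤ᴿ-total x y = [ inj₁ , (λ x≰y → inj₂ (≰⇒≥ em {x} {y} x≰y)) ]′ (toSum em)

-- The boundary of a proper down-set as a graph over Δ.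

module Boundary where
  open import Data.Integer.Base using (_+_; _-_)
  open RealOrder
  open Projection
  open Facets
  open SurfaceHeight
  open Lattice

  some-index : ∀ d → .{{NonZero d}} → Fin d
  some-index (suc d) = zero

  -- The boundary of the union of the cubes x + [0,1]ᵈ, x ∈ D, for a down-set D.
  OnBoundary : ∀ {d} → (Vec ℤ d → Set) → ℝ^ d → Set
  OnBoundary D p = (∃[ x ] D x × (∀ k → p k ≤ᴿ fromℤ (lookup x k + 1ℤ))) ×
                   (∃[ z ] ¬ D z × (∀ k → fromℤ (lookup z k) ≤ᴿ p k))

  OnBoundary-resp-≋ : ∀ {d} {D : Vec ℤ d → Set} {p q} → p ≋ q → OnBoundary D p → OnBoundary D q
  OnBoundary-resp-≋ {p = p} {q} p≋q ((x , Dx , p≤) , (z , ¬Dz , ≤p)) =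
    (x , Dx , λ k → ≤ᴿ-trans {q k} {p k} {fromℤ (lookup x k + 1ℤ)} (proj₂ (p≋q k)) (p≤ k)) ,
    (z , ¬Dz , λ k → ≤ᴿ-trans {fromℤ (lookup z k)} {p k} {q k} (≤p k) (proj₁ (p≋q k)))

  module _ (em : ExcludedMiddle 0ℓ) {d} (D : Vec ℤ d → Set)
           (D-down : ∀ {x y} → x ≤ᵛ y → D y → D x) where

    -- With a negative, z ≤ p′ ≤ p + a would lie strictly below x + (1,...,1); for lattice points
    -- this means z ≤ x, although x is in D and z is not. Uniqueness of the boundary point on a line
    -- and the Lipschitz bound both follow from this.
    boundary-gap : ∀ {p p′} a → OnBoundary D p → OnBoundary D p′ →
                   (∀ k → p′ k ≤ᴿ p k +ᴿ a) → 0ᴿ ≤ᴿ a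
    boundary-gap {p} {p′} a ((x , Dx , p≤) , _) (_ , (z , ¬Dz , ≤p′)) p′≤ = decide em
      where
      decide : Dec (0ᴿ ≤ᴿ a) → 0ᴿ ≤ᴿ a
      decide (yes 0≤a) = 0≤a
      decide (no  0≰a) = contradiction (D-down z≤x Dx) ¬Dz
        where
        p≤p+a⇒0≤a : ∀ k → p k ≤ᴿ p k +ᴿ a → 0ᴿ ≤ᴿ a
        p≤p+a⇒0≤a k le = ≤-by {p k} {p k +ᴿ a} {a} {0ᴿ} le λ n → arith (seq (p k) n) (seq a n)
          where
          arith : ∀ p a → a ℚ.- 0ℚ ≡ (p ℚ.+ a) ℚ.- p
          arith = solve-∀ ℚ-ring
        z≤x : z ≤ᵛ x
        z≤x k = [ (λ z≤x → z≤x) , (λ z≰x → contradiction (p≤p+a⇒0≤a k (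
            ≤ᴿ-trans {p k} {fromℤ (lookup x k + 1ℤ)} {p k +ᴿ a} (p≤ k) (
            ≤ᴿ-trans {fromℤ (lookup x k + 1ℤ)} {fromℤ (lookup z k)} {p k +ᴿ a} (fromℤ-mono-≤ (≰⇒+1≤ z≰x)) (
            ≤ᴿ-trans {fromℤ (lookup z k)} {p′ k} {p k +ᴿ a} (≤p′ k) (p′≤ k))))) 0≰a) ]′
          (toSum (lookup z k ℤ.≤? lookup x k))

    -- With b the floor of p and m the minimum of x and b, m is in D, b is not, and b ≤ p ≤ m +
    -- (1,...,1). An edge from y to y + eᵢ leaving D between m and b gives pᵢ ≤ mᵢ + 1 ≤ yᵢ + 1 ≤ bᵢ
    -- ≤ pᵢ, so p lies on the facet (y, i).
    boundary⇒facet : ∀ {p} → OnBoundary D p →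
      ∃[ y ] ∃[ i ] (D y × ¬ D (y +ᵛ e i)) × Facet y i p
    boundary⇒facet {p} ((x , Dx , p≤) , (z , ¬Dz , ≤p)) =
      let y , i , m≤y , y+e≤b , Dy , ¬Dy = crossing D (λ _ → em) m b m≤b Dm ¬Db
      in y , i , (Dy , ¬Dy) , bounds⇒facet y i p
           ( ≤ᴿ-trans {p i} {fromℤ (lookup m i + 1ℤ)} {fromℤ (lookup y i + 1ℤ)} (p≤m i) (fromℤ-mono-≤ (ℤ.+-monoˡ-≤ 1ℤ (m≤y i)))
           , ≤ᴿ-trans {fromℤ (lookup y i + 1ℤ)} {fromℤ (lookup b i)} {p i}
               (fromℤ-mono-≤ (subst (ℤ._≤ lookup b i) (lookup-+ᵛ-e-≡ y i) (y+e≤b i))) (b≤p i))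
           λ k k≢i →
             ≤ᴿ-trans {fromℤ (lookup y k)} {fromℤ (lookup b k)} {p k}
               (fromℤ-mono-≤ (subst (ℤ._≤ lookup b k) (lookup-+ᵛ-e-≢ y k≢i) (y+e≤b k))) (b≤p k) ,
             ≤ᴿ-trans {p k} {fromℤ (lookup m k + 1ℤ)} {fromℤ (lookup y k + 1ℤ)} (p≤m k) (fromℤ-mono-≤ (ℤ.+-monoˡ-≤ 1ℤ (m≤y k)))
      where
      b m : Vec ℤ d
      b = tabulate λ k → proj₁ (floor em (p k))
      m = zipWith ℤ._⊓_ x b
      lookup-b : ∀ k → lookup b k ≡ proj₁ (floor em (p k))
      lookup-b = Vec.lookup∘tabulate (λ k → proj₁ (floor em (p k)))
      lookup-m : ∀ k → lookup m k ≡ lookup x k ℤ.⊓ lookup b k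
      lookup-m k = Vec.lookup-zipWith ℤ._⊓_ k x b
      b≤p : ∀ k → fromℤ (lookup b k) ≤ᴿ p k
      b≤p k = subst (λ z → fromℤ z ≤ᴿ p k) (sym (lookup-b k)) (proj₁ (proj₂ (floor em (p k))))
      b+1≰p : ∀ k → ¬ fromℤ (lookup b k + 1ℤ) ≤ᴿ p k
      b+1≰p k = subst (λ z → ¬ fromℤ (z + 1ℤ) ≤ᴿ p k) (sym (lookup-b k)) (proj₂ (proj₂ (floor em (p k))))
      z≤b : z ≤ᵛ b
      z≤b k = [ (λ z≤b → z≤b) , (λ z≰b → contradiction
          (≤ᴿ-trans {fromℤ (lookup b k + 1ℤ)} {fromℤ (lookup z k)} {p k} (fromℤ-mono-≤ (≰⇒+1≤ z≰b)) (≤p k)) (b+1≰p k)) ]′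
        (toSum (lookup z k ℤ.≤? lookup b k))
      ¬Db : ¬ D b
      ¬Db Db = ¬Dz (D-down z≤b Db)
      m≤b : m ≤ᵛ b
      m≤b k = subst (ℤ._≤ lookup b k) (sym (lookup-m k)) (ℤ.i⊓j≤j (lookup x k) (lookup b k))
      Dm : D m
      Dm = D-down (λ k → subst (ℤ._≤ lookup x k) (sym (lookup-m k)) (ℤ.i⊓j≤i (lookup x k) (lookup b k))) Dx
      p≤m : ∀ k → p k ≤ᴿ fromℤ (lookup m k + 1ℤ)
      p≤m k = subst (λ z → p k ≤ᴿ fromℤ (z + 1ℤ)) (sym (lookup-m k))
        ([ (λ eq → subst (λ z → p k ≤ᴿ fromℤ (z + 1ℤ)) (sym eq) (p≤ k))
         , (λ eq → subst (λ z → p k ≤ᴿ fromℤ (z + 1ℤ)) (sym eq) (≰⇒≥ em {fromℤ (lookup b k + 1ℤ)} {p k} (b+1≰p k)))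
         ]′ (ℤ.⊓-sel (lookup x k) (lookup b k)))

    facet⇒boundary : ∀ {p y i} → D y → ¬ D (y +ᵛ e i) → Facet y i p → OnBoundary D p
    facet⇒boundary {p} {y} {i} Dy ¬Dy facet = on (facet⇒bounds y i p facet)
      where
      on : p i ≈ᴿ fromℤ (lookup y i + 1ℤ) ×
           (∀ k → k ≢ i → fromℤ (lookup y k) ≤ᴿ p k × p k ≤ᴿ fromℤ (lookup y k + 1ℤ)) → OnBoundary D p
      on (at-i , off-i) = (y , Dy , above) , (y +ᵛ e i , ¬Dy , below)
        where
        above : ∀ k → p k ≤ᴿ fromℤ (lookup y k + 1ℤ)
        above k = [ (λ { refl → proj₁ at-i }) , (λ k≢i → proj₂ (off-i k k≢i)) ]′ (toSum (k Fin.≟ i))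
        below : ∀ k → fromℤ (lookup (y +ᵛ e i) k) ≤ᴿ p k
        below k = [ (λ { refl → subst (λ z → fromℤ z ≤ᴿ p k) (sym (lookup-+ᵛ-e-≡ y k)) (proj₂ at-i) })
                  , (λ k≢i → subst (λ z → fromℤ z ≤ᴿ p k) (sym (lookup-+ᵛ-e-≢ y k≢i)) (proj₁ (off-i k k≢i))) ]′ (toSum (k Fin.≟ i))

    raise : Vec ℤ d → (Fin d → Set) → Vec ℤ d
    raise B S = tabulate λ j → lookup B j + (if does (em {S j}) then 1ℤ else 0ℤ)

    raise-∈ : ∀ B S {j} → S j → lookup (raise B S) j ≡ lookup B j + 1ℤ
    raise-∈ B S {j} s = trans (Vec.lookup∘tabulate _ j) (cong (lookup B j +_) (value em))
      where
      value : (S? : Dec (S j)) → (if does S? then 1ℤ else 0ℤ) ≡ 1ℤ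
      value (yes _) = refl
      value (no ¬s) = contradiction s ¬s

    raise-∉ : ∀ B S {j} → ¬ S j → lookup (raise B S) j ≡ lookup B j
    raise-∉ B S {j} ¬s = trans (Vec.lookup∘tabulate _ j) (trans (cong (lookup B j +_) (value em)) (ℤ.+-identityʳ (lookup B j)))
      where
      value : (S? : Dec (S j)) → (if does S? then 1ℤ else 0ℤ) ≡ 0ℤ
      value (yes s) = contradiction s ¬s
      value (no _)  = refl

    B≤raise : ∀ B S → B ≤ᵛ raise B S
    B≤raise B S j = [ (λ s → subst (lookup B j ℤ.≤_) (sym (raise-∈ B S s)) (i≤i+1 (lookup B j)))
                    , (λ ¬s → ℤ.≤-reflexive (sym (raise-∉ B S ¬s))) ]′ (toSum (em {S j}))

    raise-mono : ∀ B S T → (∀ {j} → S j → T j) → raise B S ≤ᵛ raise B T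
    raise-mono B S T S⊆T j = [ (λ s → ℤ.≤-reflexive (trans (raise-∈ B S s) (sym (raise-∈ B T (S⊆T s)))))
      , (λ ¬s → subst (ℤ._≤ lookup (raise B T) j) (sym (raise-∉ B S ¬s)) (B≤raise B T j)) ]′ (toSum (em {S j}))

    -- Moving up from the cube B along (1,…,1), the line through q crosses
    -- the j-th upper face at time c j; the boundary is met at the first
    -- crossing that leaves D.
    boundary-crossing : .{{NonZero d}} → ∀ q B → (∀ k → fromℤ (lookup B k) ≤ᴿ q k) →
      (∀ k → q k ≤ᴿ fromℤ (lookup B k + 1ℤ)) → D B → (∀ y → (∀ k → lookup B k + 1ℤ ℤ.≤ lookup y k) → ¬ D y) →
      ∃[ t ] OnBoundary D (q +¹ t)
    boundary-crossing q B B≤q q≤B+1 DB ¬DB+1 = c k , (X , DX , below) , (crossed k , k-exits , above)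
      where
      c : Fin d → ℝ
      c j = fromℤ (lookup B j + 1ℤ) -ᴿ q j
      crossed : Fin d → Vec ℤ d
      crossed k = raise B (λ j → c j ≤ᴿ c k)
      -- After the last crossing all coordinates are raised and D has been left, so some crossing
      -- leaves D and the first such one exists.
      last : ∃[ k ] ⊤ × (∀ j → ⊤ → c j ≤ᴿ c k)
      last = least em (λ x y → y ≤ᴿ x) (λ {x} {y} {z} y≤x z≤y → ≤ᴿ-trans {z} {y} {x} z≤y y≤x)
        (λ x y → ≤ᴿ-total em y x) c (λ _ → ⊤) (some-index d , tt)
      exit : ∃[ k ] ¬ D (crossed k) × (∀ j → ¬ D (crossed j) → c k ≤ᴿ c j)
      exit = least em _≤ᴿ_ (λ {x} {y} {z} → ≤ᴿ-trans {x} {y} {z}) (≤ᴿ-total em) c (λ k → ¬ D (crossed k))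
        (proj₁ last , ¬DB+1 _ λ j → ℤ.≤-reflexive (sym (raise-∈ B (λ j → c j ≤ᴿ c (proj₁ last)) (proj₂ (proj₂ last) j tt))))
      k : Fin d
      k = proj₁ exit
      k-exits : ¬ D (crossed k)
      k-exits = proj₁ (proj₂ exit)
      -- Strictly earlier crossings only, whereas `crossed k` includes ties. The raised cube `X` is
      -- in D: it is `B` if there are none, and otherwise lies below the cube reached at the latest
      -- of them, which has not left D.
      Before : Fin d → Set
      Before j = ¬ c k ≤ᴿ c j
      X : Vec ℤ d
      X = raise B Before
      DX : D X
      DX = cases em
        where
        cases : Dec (∃[ j ] Before j) → D X
        cases (no none) = D-down (λ j → ℤ.≤-reflexive (raise-∉ B Before λ s → none (j , s))) DB
        cases (yes some) = latest (least em (λ x y → y ≤ᴿ x) (λ {x} {y} {z} y≤x z≤y → ≤ᴿ-trans {z} {y} {x} z≤y y≤x)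
            (λ x y → ≤ᴿ-total em y x) c Before some)
          where
          latest : (∃[ j ] Before j × (∀ l → Before l → c l ≤ᴿ c j)) → D X
          latest (j , before , latest-j) = inside em
            where
            inside : Dec (D (crossed j)) → D X
            inside (yes Dj) = D-down (raise-mono B Before (λ l → c l ≤ᴿ c j) (λ {l} → latest-j l)) Dj
            inside (no ¬Dj) = contradiction (proj₂ (proj₂ exit) j ¬Dj) before
      below : ∀ j → q j +ᴿ c k ≤ᴿ fromℤ (lookup X j + 1ℤ)
      below j = [ in-X , out-X ]′ (toSum (em {Before j}))
        where
        in-X : Before j → q j +ᴿ c k ≤ᴿ fromℤ (lookup X j + 1ℤ)
        -- Here the bound is Bⱼ + 2, and c k ≤ 1 because qₖ ≥ Bₖ.
        in-X s = ≤-by {q j +ᴿ fromℤ (lookup B k)} {fromℤ (lookup B j + 1ℤ) +ᴿ q k} {fromℤ (lookup X j + 1ℤ)} {q j +ᴿ c k}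
          (+-mono-≤ᴿ {q j} {fromℤ (lookup B j + 1ℤ)} {fromℤ (lookup B k)} {q k} (q≤B+1 j) (B≤q k))
          λ n → trans (cong₂ (λ a b → a ℚ.- (seq (q j) n ℚ.+ (b ℚ.- seq (q k) n)))
              (trans (cong (λ z → (z + 1ℤ) ℚ./ 1) (raise-∈ B Before s)) (/1-homo-+ (lookup B j + 1ℤ) 1ℤ)) (/1-homo-+ (lookup B k) 1ℤ))
            (arith (seq (q j) n) (seq (q k) n) ((lookup B j + 1ℤ) ℚ./ 1) (lookup B k ℚ./ 1))
          where
          arith : ∀ qⱼ qₖ b bₖ → (b ℚ.+ 1ℚ) ℚ.- (qⱼ ℚ.+ ((bₖ ℚ.+ 1ℚ) ℚ.- qₖ)) ≡ (b ℚ.+ qₖ) ℚ.- (qⱼ ℚ.+ bₖ)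
          arith = solve-∀ ℚ-ring
        out-X : ¬ Before j → q j +ᴿ c k ≤ᴿ fromℤ (lookup X j + 1ℤ)
        out-X ¬s = ≤-by {c k} {c j} {fromℤ (lookup X j + 1ℤ)} {q j +ᴿ c k} (decide em)
          λ n → trans (cong (λ z → (z + 1ℤ) ℚ./ 1 ℚ.- (seq (q j) n ℚ.+ seq (c k) n)) (raise-∉ B Before ¬s))
            (arith (seq (q j) n) (seq (c k) n) ((lookup B j + 1ℤ) ℚ./ 1))
          where
          decide : Dec (c k ≤ᴿ c j) → c k ≤ᴿ c j
          decide (yes le) = le
          decide (no nle) = contradiction nle ¬s
          arith : ∀ qⱼ cₖ b → b ℚ.- (qⱼ ℚ.+ cₖ) ≡ (b ℚ.- qⱼ) ℚ.- cₖ
          arith = solve-∀ ℚ-ring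
      above : ∀ j → fromℤ (lookup (crossed k) j) ≤ᴿ q j +ᴿ c k
      above j = [ in-Z , out-Z ]′ (toSum (em {c j ≤ᴿ c k}))
        where
        in-Z : c j ≤ᴿ c k → fromℤ (lookup (crossed k) j) ≤ᴿ q j +ᴿ c k
        in-Z s = ≤-by {c j} {c k} {q j +ᴿ c k} {fromℤ (lookup (crossed k) j)} s
          λ n → trans (cong (λ z → (seq (q j) n ℚ.+ seq (c k) n) ℚ.- z ℚ./ 1) (raise-∈ B (λ j → c j ≤ᴿ c k) s))
            (arith (seq (q j) n) (seq (c k) n) ((lookup B j + 1ℤ) ℚ./ 1))
          where
          arith : ∀ qⱼ cₖ b → (qⱼ ℚ.+ cₖ) ℚ.- b ≡ cₖ ℚ.- (b ℚ.- qⱼ)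
          arith = solve-∀ ℚ-ring
        out-Z : ¬ c j ≤ᴿ c k → fromℤ (lookup (crossed k) j) ≤ᴿ q j +ᴿ c k
        -- Here the bound is Bⱼ, and c k ≥ 0 because qₖ ≤ Bₖ + 1.
        out-Z ¬s = ≤-by {fromℤ (lookup B j) +ᴿ q k} {q j +ᴿ fromℤ (lookup B k + 1ℤ)} {q j +ᴿ c k} {fromℤ (lookup (crossed k) j)}
          (+-mono-≤ᴿ {fromℤ (lookup B j)} {q j} {q k} {fromℤ (lookup B k + 1ℤ)} (B≤q j) (q≤B+1 k))
          λ n → trans (cong (λ z → (seq (q j) n ℚ.+ seq (c k) n) ℚ.- z ℚ./ 1) (raise-∉ B (λ j → c j ≤ᴿ c k) ¬s))
            (arith (seq (q j) n) (seq (q k) n) (lookup B j ℚ./ 1) ((lookup B k + 1ℤ) ℚ./ 1))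
          where
          arith : ∀ qⱼ qₖ b bₖ → (qⱼ ℚ.+ (bₖ ℚ.- qₖ)) ℚ.- b ≡ (qⱼ ℚ.+ bₖ) ℚ.- (b ℚ.+ qₖ)
          arith = solve-∀ ℚ-ring

  module _ (em : ExcludedMiddle 0ℓ) {d} .{{nz : NonZero d}} (D : Vec ℤ d → Set)
           (D-down : ∀ {x y} → x ≤ᵛ y → D y → D x) (D-inhabited : ∃[ x ] D x) (D-proper : ∃[ x ] ¬ D x) where

    abstract
      -- The diagonal translates of the floor of q belong to D far down and not far up. After the
      -- last one in D, the next translate and everything above it are outside, which is the
      -- situation of `boundary-crossing`.
      boundary-above : ∀ q → ∃[ t ] OnBoundary D (q +¹ t)
      boundary-above q =
        let L , L≤ = lower-bound λ k → lookup (proj₁ D-inhabited) k - lookup b k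
            U , ≤U = upper-bound λ k → lookup (proj₁ D-proper) k - lookup b k
            D-L : D (shift L)
            D-L = D-down (λ k → ≤ℤ-by (L≤ k) (trans (cong (λ z → lookup (proj₁ D-inhabited) k - z) (lookup-shift L k))
                    (lo (lookup (proj₁ D-inhabited) k) (lookup b k) L))) (proj₂ D-inhabited)
            ¬D-U : ¬ D (shift U)
            ¬D-U D-U = proj₂ D-proper (D-down (λ k → ≤ℤ-by (≤U k) (trans (cong (λ z → z - lookup (proj₁ D-proper) k) (lookup-shift U k))
                    (hi (lookup (proj₁ D-proper) k) (lookup b k) U))) D-U)
            L≤U : L ℤ.≤ U
            L≤U = [ (λ L≤U → L≤U) , (λ U≤L → contradiction (D-down (shift-mono U≤L) D-L) ¬D-U) ]′ (ℤ.≤-total L U)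
            m , _ , _ , Dm , ¬Dm+1 = last-true (λ m → D (shift m)) (λ _ → em) L≤U D-L ¬D-U
            t , on = boundary-crossing em D D-down {{nz}} (q +¹ fromℤ m) (shift m) (shift≤ m) (≤shift+1 m) Dm
              λ y ≤y Dy → ¬Dm+1 (D-down (λ k → subst (ℤ._≤ lookup y k) (next m k) (≤y k)) Dy)
        in fromℤ m +ᴿ t , OnBoundary-resp-≋ {D = D} {q +¹ fromℤ m +¹ t} {q +¹ (fromℤ m +ᴿ t)}
             (λ k → ≗⇒≈ {q k +ᴿ fromℤ m +ᴿ t} {q k +ᴿ (fromℤ m +ᴿ t)} λ n → ℚ.+-assoc (seq (q k) n) (m ℚ./ 1) (seq t n)) on
        where
        b : Vec ℤ d
        b = tabulate λ k → proj₁ (floor em (q k))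
        lookup-b : ∀ k → lookup b k ≡ proj₁ (floor em (q k))
        lookup-b = Vec.lookup∘tabulate (λ k → proj₁ (floor em (q k)))
        b≤q : ∀ k → fromℤ (lookup b k) ≤ᴿ q k
        b≤q k = subst (λ z → fromℤ z ≤ᴿ q k) (sym (lookup-b k)) (proj₁ (proj₂ (floor em (q k))))
        q≤b+1 : ∀ k → q k ≤ᴿ fromℤ (lookup b k + 1ℤ)
        q≤b+1 k = subst (λ z → q k ≤ᴿ fromℤ (z + 1ℤ)) (sym (lookup-b k))
          (≰⇒≥ em {fromℤ (proj₁ (floor em (q k)) + 1ℤ)} {q k} (proj₂ (proj₂ (floor em (q k)))))
        shift : ℤ → Vec ℤ d
        shift m = tabulate λ k → lookup b k + m
        lookup-shift : ∀ m k → lookup (shift m) k ≡ lookup b k + m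
        lookup-shift m = Vec.lookup∘tabulate (λ k → lookup b k + m)
        shift-mono : ∀ {m n} → m ℤ.≤ n → shift m ≤ᵛ shift n
        shift-mono {m} {n} m≤n k = subst₂ ℤ._≤_ (sym (lookup-shift m k)) (sym (lookup-shift n k)) (ℤ.+-monoʳ-≤ (lookup b k) m≤n)
        next : ∀ m k → lookup (shift m) k + 1ℤ ≡ lookup (shift (m + 1ℤ)) k
        next m k = trans (cong (_+ 1ℤ) (lookup-shift m k)) (trans (ℤ.+-assoc (lookup b k) m 1ℤ) (sym (lookup-shift (m + 1ℤ) k)))
        lo : ∀ x b L → x - (b + L) ≡ x - b - L
        lo = solveℤ
        hi : ∀ x b U → b + U - x ≡ U - (x - b)
        hi = solveℤ
        shift≤ : ∀ m k → fromℤ (lookup (shift m) k) ≤ᴿ q k +ᴿ fromℤ m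
        shift≤ m k = ≤-by {fromℤ (lookup b k)} {q k} {q k +ᴿ fromℤ m} {fromℤ (lookup (shift m) k)} (b≤q k)
          λ n → trans (cong (λ z → (seq (q k) n ℚ.+ m ℚ./ 1) ℚ.- z) (trans (cong (ℚ._/ 1) (lookup-shift m k)) (/1-homo-+ (lookup b k) m)))
            (arith (seq (q k) n) (lookup b k ℚ./ 1) (m ℚ./ 1))
          where
          arith : ∀ q b m → (q ℚ.+ m) ℚ.- (b ℚ.+ m) ≡ q ℚ.- b
          arith = solve-∀ ℚ-ring
        ≤shift+1 : ∀ m k → q k +ᴿ fromℤ m ≤ᴿ fromℤ (lookup (shift m) k + 1ℤ)
        ≤shift+1 m k = ≤-by {q k} {fromℤ (lookup b k + 1ℤ)} {fromℤ (lookup (shift m) k + 1ℤ)} {q k +ᴿ fromℤ m} (q≤b+1 k)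
          λ n → trans (cong (λ z → z ℚ.- (seq (q k) n ℚ.+ m ℚ./ 1)) (trans (cong (ℚ._/ 1) (trans (cong (_+ 1ℤ) (lookup-shift m k)) (comm (lookup b k) m)))
                                                                   (/1-homo-+ (lookup b k + 1ℤ) m)))
            (arith (seq (q k) n) ((lookup b k + 1ℤ) ℚ./ 1) (m ℚ./ 1))
          where
          comm : ∀ b m → b + m + 1ℤ ≡ b + 1ℤ + m
          comm = solveℤ
          arith : ∀ q b m → (b ℚ.+ m) ℚ.- (q ℚ.+ m) ≡ b ℚ.- q
          arith = solve-∀ ℚ-ring

  -- Both π and its inverse at most double sup-norm distances, so δ = ε/4 leads to ε/2, which leaves
  -- room for the strict inequality in `Close`.
  ¼ᴿ_ : ℝ → ℝ
  ¼ᴿ ε = (½ ℚ.* ½) *ᴿ ε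

  ¼ᴿ-pos : ∀ {ε} → 0ᴿ <ᴿ ε → 0ᴿ <ᴿ ¼ᴿ ε
  ¼ᴿ-pos {ε} (η , 0<η , N , p) = ½ ℚ.* (½ ℚ.* η) , ½* (½* 0<η) , N , λ n N≤n →
    <-by (ℚ.*-monoʳ-<-pos (½ ℚ.* ½) (p n N≤n)) (arith (seq ε n) η)
    where
    arith : ∀ e h → ½ ℚ.* ½ ℚ.* e ℚ.- (0ℚ ℚ.+ ½ ℚ.* (½ ℚ.* h)) ≡ ½ ℚ.* ½ ℚ.* e ℚ.- ½ ℚ.* ½ ℚ.* (0ℚ ℚ.+ h)
    arith = solve-∀ ℚ-ring

  ≤½⇒< : ∀ {x ε} → 0ᴿ <ᴿ ε → x ≤ᴿ ¼ᴿ ε +ᴿ ¼ᴿ ε → x <ᴿ ε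
  ≤½⇒< {x} {ε} (η , 0<η , N , p) x≤ = ≤-<-trans {x} {¼ᴿ ε +ᴿ ¼ᴿ ε} {ε} x≤
    (½ ℚ.* η , ½* 0<η , N , λ n N≤n → <-by (ℚ.*-monoʳ-<-pos ½ (p n N≤n)) (arith (seq ε n) η))
    where
    arith : ∀ e h → e ℚ.- (½ ℚ.* ½ ℚ.* e ℚ.+ ½ ℚ.* ½ ℚ.* e ℚ.+ ½ ℚ.* h) ≡ ½ ℚ.* e ℚ.- ½ ℚ.* (0ℚ ℚ.+ h)
    arith = solve-∀ ℚ-ring

  -ᴿ≤⇒≤+ᴿ : ∀ {x y a} → x -ᴿ y ≤ᴿ a → x ≤ᴿ y +ᴿ a
  -ᴿ≤⇒≤+ᴿ {x} {y} {a} le = ≤-by {x -ᴿ y} {a} {y +ᴿ a} {x} le λ n → arith (seq x n) (seq y n) (seq a n)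
    where
    arith : ∀ x y a → (y ℚ.+ a) ℚ.- x ≡ a ℚ.- (x ℚ.+ ℚ.- y)
    arith = solve-∀ ℚ-ring

  module _ {d} .{{nz : NonZero d}} where

    π-close : ∀ {p q : ℝ^ d} {δ} → (∀ k → p k ≤ᴿ q k +ᴿ δ) → (∀ k → q k ≤ᴿ p k +ᴿ δ) →
              ∀ k → π {{nz}} p k -ᴿ π {{nz}} q k ≤ᴿ δ +ᴿ δ
    π-close {p} {q} {δ} p≤q+δ q≤p+δ k =
      ≤-by {p k +ᴿ mean {{nz}} q} {q k +ᴿ δ +ᴿ mean {{nz}} (p +¹ δ)} {δ +ᴿ δ} {π {{nz}} p k -ᴿ π {{nz}} q k}
        (+-mono-≤ᴿ {p k} {q k +ᴿ δ} {mean {{nz}} q} {mean {{nz}} (p +¹ δ)} (p≤q+δ k) (mean-mono-≤ {{nz}} {p = q} {q = p +¹ δ} q≤p+δ))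
        λ n → trans (arith (seq (p k) n) (seq (q k) n) (seq δ n) (seq (mean {{nz}} p) n) (seq (mean {{nz}} q) n))
          (cong (λ z → (seq (q k) n ℚ.+ seq δ n ℚ.+ z) ℚ.- (seq (p k) n ℚ.+ seq (mean {{nz}} q) n)) (sym (mean-+¹ {{nz}} p δ n)))
      where
      arith : ∀ p q δ m m′ → (δ ℚ.+ δ) ℚ.- ((p ℚ.+ ℚ.- m) ℚ.+ ℚ.- (q ℚ.+ ℚ.- m′)) ≡ (q ℚ.+ δ ℚ.+ (m ℚ.+ δ)) ℚ.- (p ℚ.+ m′)
      arith = solve-∀ ℚ-ring

    π-continuous : ∀ (A : Subset d) → ContinuousOn (π {{nz}}) A
    π-continuous A p _ ε 0<ε = ¼ᴿ ε , ¼ᴿ-pos {ε} 0<ε , λ q _ close k →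
      let p≤q k = -ᴿ≤⇒≤+ᴿ {p k} {q k} {¼ᴿ ε} (<⇒≤ {p k -ᴿ q k} {¼ᴿ ε} (proj₁ (close k)))
          q≤p k = -ᴿ≤⇒≤+ᴿ {q k} {p k} {¼ᴿ ε} (<⇒≤ {q k -ᴿ p k} {¼ᴿ ε} (proj₂ (close k)))
      in ≤½⇒< {π {{nz}} p k -ᴿ π {{nz}} q k} {ε} 0<ε (π-close {p} {q} {¼ᴿ ε} p≤q q≤p k) ,
         ≤½⇒< {π {{nz}} q k -ᴿ π {{nz}} p k} {ε} 0<ε (π-close {q} {p} {¼ᴿ ε} q≤p p≤q k)

  module _ (em : ExcludedMiddle 0ℓ) {d} .{{nz : NonZero d}} (D : Vec ℤ d → Set)
           (D-down : ∀ {x y} → x ≤ᵛ y → D y → D x) (D-inhabited : ∃[ x ] D x) (D-proper : ∃[ x ] ¬ D x) where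

    lift : ℝ^ d → ℝ
    lift q = proj₁ (boundary-above em D D-down D-inhabited D-proper q)

    lift-on : ∀ q → OnBoundary D (q +¹ lift q)
    lift-on q = proj₂ (boundary-above em D D-down D-inhabited D-proper q)

    -- `boundary-gap` applies with a = δ + lift q - lift p, as p + lift p + a is p + δ + lift q,
    -- which is above q + lift q.
    lift-close : ∀ {p q δ} → (∀ k → q k ≤ᴿ p k +ᴿ δ) → lift p ≤ᴿ lift q +ᴿ δ
    lift-close {p} {q} {δ} q≤p+δ = ≤-by {0ᴿ} {δ +ᴿ lift q -ᴿ lift p} {lift q +ᴿ δ} {lift p}
      (boundary-gap em D D-down {p +¹ lift p} {q +¹ lift q} (δ +ᴿ lift q -ᴿ lift p) (lift-on p) (lift-on q)
        λ k → ≤-by {q k} {p k +ᴿ δ} {p k +ᴿ lift p +ᴿ (δ +ᴿ lift q -ᴿ lift p)} {q k +ᴿ lift q} (q≤p+δ k)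
          λ n → arith (seq (p k) n) (seq (q k) n) (seq δ n) (seq (lift p) n) (seq (lift q) n))
      λ n → arith′ (seq δ n) (seq (lift p) n) (seq (lift q) n)
      where
      arith : ∀ p q δ s t → (p ℚ.+ s ℚ.+ (δ ℚ.+ t ℚ.+ ℚ.- s)) ℚ.- (q ℚ.+ t) ≡ (p ℚ.+ δ) ℚ.- q
      arith = solve-∀ ℚ-ring
      arith′ : ∀ δ s t → (t ℚ.+ δ) ℚ.- s ≡ (δ ℚ.+ t ℚ.+ ℚ.- s) ℚ.- 0ℚ
      arith′ = solve-∀ ℚ-ring

    -- Both points are on the boundary and differ by c + t along (1,...,1); `boundary-gap` in the
    -- two directions makes c + t both nonnegative and nonpositive.
    lift-unique : ∀ {p} c → OnBoundary D p → (p +¹ c) +¹ lift (p +¹ c) ≋ p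
    lift-unique {p} c on k =
      ≤-by {0ᴿ} { -ᴿ (c +ᴿ t)} {p k} {p k +ᴿ c +ᴿ t} 0≤-s (λ n → arith₁ (seq (p k) n) (seq c n) (seq t n)) ,
      ≤-by {0ᴿ} {c +ᴿ t} {p k +ᴿ c +ᴿ t} {p k} 0≤s (λ n → arith₂ (seq (p k) n) (seq c n) (seq t n))
      where
      t : ℝ
      t = lift (p +¹ c)
      arith₁ : ∀ p c t → p ℚ.- (p ℚ.+ c ℚ.+ t) ≡ ℚ.- (c ℚ.+ t) ℚ.- 0ℚ
      arith₁ = solve-∀ ℚ-ring
      arith₂ : ∀ p c t → (p ℚ.+ c ℚ.+ t) ℚ.- p ≡ (c ℚ.+ t) ℚ.- 0ℚ
      arith₂ = solve-∀ ℚ-ring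
      back : ∀ p c t → p ≡ p ℚ.+ c ℚ.+ t ℚ.+ ℚ.- (c ℚ.+ t)
      back = solve-∀ ℚ-ring
      0≤s : 0ᴿ ≤ᴿ c +ᴿ t
      0≤s = boundary-gap em D D-down {p} {p +¹ c +¹ t} (c +ᴿ t) on (lift-on (p +¹ c))
        λ k → ≗⇒≤ {p k +ᴿ c +ᴿ t} {p k +ᴿ (c +ᴿ t)} λ n → ℚ.+-assoc (seq (p k) n) (seq c n) (seq t n)
      0≤-s : 0ᴿ ≤ᴿ -ᴿ (c +ᴿ t)
      0≤-s = boundary-gap em D D-down {p +¹ c +¹ t} {p} (-ᴿ (c +ᴿ t)) (lift-on (p +¹ c)) on
        λ k → ≗⇒≤ {p k} {p k +ᴿ c +ᴿ t +ᴿ -ᴿ (c +ᴿ t)} λ n → back (seq (p k) n) (seq c n) (seq t n)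

    boundary-homeomorphism : (A : Subset d) → (∀ {p} → OnBoundary D p → A p) → (∀ {p} → A p → OnBoundary D p) →
                             RestrictsToHomeomorphism (π {{nz}}) A (Δ d)
    boundary-homeomorphism A boundary⇒A A⇒boundary = record
      { inverse         = λ q → q +¹ lift q
      ; to              = λ p _ → π∈Δ {{nz}} p
      ; from            = λ q _ → boundary⇒A (lift-on q)
      -- Projecting p is translating it by minus its mean, so that translation is the `c` to use.
      ; inverseˡ        = λ p Ap → lift-unique {p} (-ᴿ mean {{nz}} p) (A⇒boundary Ap)
      ; inverseʳ        = λ q q∈Δ k → ≈ᴿ-trans {π {{nz}} (q +¹ lift q) k} {π {{nz}} q k} {q k}
          (≗⇒≈ {π {{nz}} (q +¹ lift q) k} {π {{nz}} q k} (π-+¹ {{nz}} q (lift q) k)) (π-Δ {{nz}} {q} q∈Δ k)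
      ; to-continuous   = π-continuous A
      ; from-continuous = λ p _ ε 0<ε → ¼ᴿ ε , ¼ᴿ-pos {ε} 0<ε , λ q _ close k →
          let p≤q k = -ᴿ≤⇒≤+ᴿ {p k} {q k} {¼ᴿ ε} (<⇒≤ {p k -ᴿ q k} {¼ᴿ ε} (proj₁ (close k)))
              q≤p k = -ᴿ≤⇒≤+ᴿ {q k} {p k} {¼ᴿ ε} (<⇒≤ {q k -ᴿ p k} {¼ᴿ ε} (proj₂ (close k)))
          in ≤½⇒< {(p k +ᴿ lift p) -ᴿ (q k +ᴿ lift q)} {ε} 0<ε (lifted-close {p} {q} {¼ᴿ ε} p≤q q≤p k) ,
             ≤½⇒< {(q k +ᴿ lift q) -ᴿ (p k +ᴿ lift p)} {ε} 0<ε (lifted-close {q} {p} {¼ᴿ ε} q≤p p≤q k)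
      }
      where
      lifted-close : ∀ {p q δ} → (∀ k → p k ≤ᴿ q k +ᴿ δ) → (∀ k → q k ≤ᴿ p k +ᴿ δ) →
                     ∀ k → (p k +ᴿ lift p) -ᴿ (q k +ᴿ lift q) ≤ᴿ δ +ᴿ δ
      lifted-close {p} {q} {δ} p≤q+δ q≤p+δ k =
        ≤-by {p k +ᴿ lift p} {q k +ᴿ δ +ᴿ (lift q +ᴿ δ)} {δ +ᴿ δ} {(p k +ᴿ lift p) -ᴿ (q k +ᴿ lift q)}
          (+-mono-≤ᴿ {p k} {q k +ᴿ δ} {lift p} {lift q +ᴿ δ} (p≤q+δ k) (lift-close {p} {q} {δ} q≤p+δ))
          λ n → arith (seq (p k) n) (seq (q k) n) (seq δ n) (seq (lift p) n) (seq (lift q) n)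
        where
        arith : ∀ p q δ s t → (δ ℚ.+ δ) ℚ.- ((p ℚ.+ s) ℚ.+ ℚ.- (q ℚ.+ t)) ≡ (q ℚ.+ δ ℚ.+ (t ℚ.+ δ)) ℚ.- (p ℚ.+ s)
        arith = solve-∀ ℚ-ring

  -- Binary coboundaries of 0-1 functions.

  step-01 : ∀ h → step h ≡ 0ℤ ⊎ step h ≡ 1ℤ
  step-01 (ℤ.+ zero)  = inj₁ refl
  step-01 (ℤ.+ suc _) = inj₂ refl
  step-01 -[1+ _ ]    = inj₁ refl

  module _ {d} (E : SteppedFunction d) (binary : IsBinary E) (χ : Vec ℤ d → ℤ)
           (coboundary : IsCoboundary E χ) (χ-01 : ∀ x → χ x ≡ 0ℤ ⊎ χ x ≡ 1ℤ) where

    Support : Vec ℤ d → Set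
    Support x = χ x ≡ 1ℤ

    ≢1⇒≡0 : ∀ {x} → ¬ Support x → χ x ≡ 0ℤ
    ≢1⇒≡0 {x} χ≢1 = [ (λ χ≡0 → χ≡0) , (λ χ≡1 → contradiction χ≡1 χ≢1) ]′ (χ-01 x)

    support-step : ∀ x i → Support (x +ᵛ e i) → Support x
    support-step x i χ′≡1 = [ (λ χ≡0 → contradiction (binary x i) (negative (trans (coboundary x i) (cong₂ _-_ χ≡0 χ′≡1))))
                            , (λ χ≡1 → χ≡1) ]′ (χ-01 x)
      where
      negative : ∀ {a} → a ≡ ℤ.-1ℤ → ¬ (a ≡ 0ℤ ⊎ a ≡ 1ℤ)
      negative refl (inj₁ ())
      negative refl (inj₂ ())

    -- By `crossing` for the complement, a monotone path from outside the support to a point inside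
    -- has an edge entering it, where the coboundary would be -1.
    support-down : ∀ {x y} → x ≤ᵛ y → Support y → Support x
    support-down {x} {y} x≤y Sy = decide (χ x ℤ.≟ 1ℤ)
      where
      decide : Dec (Support x) → Support x
      decide (yes Sx) = Sx
      decide (no ¬Sx) =
        let z , i , _ , _ , ¬Sz , ¬¬Sz′ = crossing (λ z → ¬ Support z) (λ z → ¬? (χ z ℤ.≟ 1ℤ)) x y x≤y ¬Sx (λ ¬Sy → ¬Sy Sy)
        in contradiction (support-step z i (decidable-stable (χ (z +ᵛ e i) ℤ.≟ 1ℤ) ¬¬Sz′)) ¬Sz

    facet⇒exit : ∀ {y i} → E y i ≡ 1ℤ → Support y × ¬ Support (y +ᵛ e i)
    facet⇒exit {y} {i} Eyi≡1 = split (χ-01 y) (χ-01 (y +ᵛ e i))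
      where
      difference : ∀ {a b} → χ y ≡ a → χ (y +ᵛ e i) ≡ b → a - b ≡ 1ℤ
      difference p q = trans (sym (trans (coboundary y i) (cong₂ _-_ p q))) Eyi≡1
      split : χ y ≡ 0ℤ ⊎ χ y ≡ 1ℤ → χ (y +ᵛ e i) ≡ 0ℤ ⊎ χ (y +ᵛ e i) ≡ 1ℤ → Support y × ¬ Support (y +ᵛ e i)
      split (inj₁ p) (inj₁ q) = contradiction (difference p q) λ ()
      split (inj₁ p) (inj₂ q) = contradiction (difference p q) λ ()
      split (inj₂ p) (inj₂ q) = contradiction (difference p q) λ ()
      split (inj₂ p) (inj₁ q) = p , λ r → contradiction (trans (sym q) r) λ ()

    exit⇒facet : ∀ {y i} → Support y → ¬ Support (y +ᵛ e i) → E y i ≡ 1ℤ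
    exit⇒facet {y} {i} Sy ¬Sy′ = trans (coboundary y i) (cong₂ _-_ Sy (≢1⇒≡0 ¬Sy′))

    coboundary⇒surface : ExcludedMiddle 0ℓ → .{{nz : NonZero d}} →
      (∃[ x ] χ x ≡ 1ℤ) → (∃[ x ] χ x ≡ 0ℤ) → IsSteppedSurface {{nz}} E
    coboundary⇒surface em {{nz}} inhabited (x₀ , χ≡0) = binary ,
      boundary-homeomorphism em {{nz}} Support support-down inhabited (x₀ , λ χ≡1 → contradiction (trans (sym χ≡0) χ≡1) λ ())
        (GeometricInterpretation E) (λ {p} → on⇒geometric {p}) (λ {p} → geometric⇒on {p})
      where
      on⇒geometric : ∀ {p} → OnBoundary Support p → GeometricInterpretation E p
      on⇒geometric {p} on = let y , i , (Sy , ¬Sy′) , facet = boundary⇒facet em Support support-down {p} on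
        in y , i , exit⇒facet Sy ¬Sy′ , facet
      geometric⇒on : ∀ {p} → GeometricInterpretation E p → OnBoundary Support p
      geometric⇒on {p} (y , i , Eyi≡1 , facet) = facet⇒boundary em Support support-down {p} {y} {i}
        (proj₁ (facet⇒exit Eyi≡1)) (proj₂ (facet⇒exit Eyi≡1)) facet

-- Pulling the down-set back along the incidence matrix.

open import Data.Nat.Base using (_≤_)
open Determinant
open DualMap
open Facets
open SurfaceHeight
open Boundary

module _ {d} .{{nz : NonZero d}} (σ : Morphism d)
         (E : SteppedFunction d) (surface : IsSteppedSurface {{nz}} E) where

  preimage-indicator : Vec ℤ d → ℤ
  preimage-indicator x = indicator {{nz}} E surface (incidence σ · x)

  -- All heights occur on ℤᵈ, and unimodularity makes each of them occur on the image of M.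
  preimage-attained : IsUnimodular σ → ∀ h → ∃[ u ] preimage-indicator u ≡ step h
  preimage-attained unimodular h =
    let x , height≡h = height-surjective {{nz}} E surface h
        u , Mu≡x = unimodular⇒surjective (incidence σ) unimodular x
    in u , cong step (trans (cong (height {{nz}} E surface) Mu≡x) height≡h)

  preimage-01 : ∀ x → preimage-indicator x ≡ 0ℤ ⊎ preimage-indicator x ≡ 1ℤ
  preimage-01 x = step-01 (height {{nz}} E surface (incidence σ · x))

  preimage-coboundary : IsCoboundary (E₁* σ E) preimage-indicator
  preimage-coboundary = E₁*-coboundary E (indicator {{nz}} E surface) (surface-coboundary {{nz}} E surface) σ

theorem4p12 : ExcludedMiddle 0ℓ →
    (d : ℕ) .{{_ : NonZero d}} → 3 ≤ d →
    (σ : Morphism d) → IsUnimodular σ →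
    (E : SteppedFunction d) → IsSteppedSurface E →
    IsBinary (E₁* σ E) → IsSteppedSurface (E₁* σ E)
theorem4p12 em d {{nz}} _ σ unimodular E surface binary =
  coboundary⇒surface (E₁* σ E) binary (preimage-indicator {{nz}} σ E surface)
    (preimage-coboundary {{nz}} σ E surface) (preimage-01 {{nz}} σ E surface) em {{nz}}
    -- Heights 1 and 0 lie on the two sides of the threshold of `step`: they show the pulled-back
    -- down-set to be inhabited and proper.
    (preimage-attained {{nz}} σ E surface unimodular 1ℤ) (preimage-attained {{nz}} σ E surface unimodular 0ℤ)
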